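{- For parameters $t_1,\ldots,t_r$, $$\mathcal{Y}(z_1;t_1)\cdots\mathcal{Y}(z_r;t_r)=\prod_{1\le i<j\le r}F_{t_i,t_j}(z_j/z_i)\;:\!\mathcal{Y}(z_1;t_1)\cdots\mathcal{Y}(z_r;t_r)\!:\,,$$ where each factor $F_{t_i,t_j}(z_j/z_i)$ is expanded in nonnegative powers of $z_j/z_i$.
   Context: The parameters $t_1,\dots,t_r$ are elements of a field $\mathbb{K}$ of characteristic $0$ with $t_i^n\neq1$ for all odd $n\ge1$ (for instance independent indeterminates, with $\mathbb{K}=\mathbb{Q}(t_1,\ldots,t_r)$). Operators act on $\Gamma_{\mathbb{K}}=\mathbb{K}[p_1,p_3,p_5,\ldots]$. For odd $n\ge1$, $a_{ -n}$ is multiplication by $p_n$ and $a_n=\frac n2\frac{\partial}{\partial p_n}$. For a parameter $t$ set $$A_t(z)=\sum_{n\ge1,\ n\text{ odd}}\frac{2(1-t^n)}{n}a_{ -n}z^n,\qquad B_t(z)=-\sum_{n\ge1,\ n\text{ odd}}\frac{2}{n(1-t^n)}a_nz^{ -n},$$ and $\mathcal{Y}(z;t)=e^{A_t(z)}e^{B_t(z)}$, a formal series in $z^{\pm1}$ with operator coefficients. The normally ordered product puts all $A$-parts to the left of all $B$-parts: $$:\!\mathcal{Y}(z_1;t_1)\cdots\mathcal{Y}(z_r;t_r)\!:\;=e^{A_{t_1}(z_1)+\cdots+A_{t_r}(z_r)}\,e^{B_{t_1}(z_1)+\cdots+B_{t_r}(z_r)}.$$ For parameters $t,s$, $$F_{t,s}(u)=\exp\Big(-2\sum_{n\ge1,\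 n\text{ odd}}\frac{1-s^n}{1-t^n}\frac{u^n}{n}\Big)\in\mathbb{K}[[u]].$$ -}

module Defs where

open import Algebra.Apartness.Bundles using (HeytingField)
open import Algebra.Bundles.Raw using (RawSemiring)
import Algebra.Definitions.RawSemiring as RawSemiringDefs
open import Data.Bool.Base using (if_then_else_)
open import Data.Fin.Base using (Fin; zero; suc)
open import Data.Integer.Base as ℤ using (ℤ; +_; -[1+_])
open import Data.List.Base as List using (List; []; _∷_; upTo; allFin; cartesianProductWith)
open import Data.List.Membership.Propositional using (_∉_)
open import Data.List.Relation.Unary.Unique.Propositional using (Unique)
open import Data.Nat.Base as ℕ using (ℕ; zero; suc; NonZero; _!)
open import Data.Nat.Properties using (_≟_; _!≢0)
open import Data.Product.Base using (_×_; _,_; proj₁; ∃-syntax; Σ-syntax)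
open import Data.Unit.Base using (⊤; tt)
open import Data.Vec.Base as Vec using (Vec; []; _∷_)
open import Function.Base using (id; _∘_)
open import Level using (Level; _⊔_)
open import Relation.Nullary.Decidable.Core using (does)

private variable
  a ℓ : Level

odd : ℕ → ℕ
odd k = suc (2 ℕ.* k)

rawSemiring : ∀ {c ℓ₁ ℓ₂} → HeytingField c ℓ₁ ℓ₂ → RawSemiring c ℓ₁
rawSemiring K = record { _≈_ = _≈_ ; _+_ = _+_ ; _*_ = _*_ ; 0# = 0# ; 1# = 1# }
  where open HeytingField K

-- Fields are Heyting fields, so that "x ≠ y" is the apartness x # y; with # the negation
-- of ≈, this is the classical condition.
CharacteristicZero : ∀ {c ℓ₁ ℓ₂} → HeytingField c ℓ₁ ℓ₂ → Set ℓ₂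
CharacteristicZero K = ∀ n → (suc n · 1#) # 0#
  where
  open HeytingField K using (_#_; 0#; 1#)
  open RawSemiringDefs (rawSemiring K) using () renaming (_×_ to _·_)

-- All pairs (a , b) of multi-indices with a + b = m.
splits : ∀ {r} → Vec ℕ r → List (Vec ℕ r × Vec ℕ r)
splits []      = ([] , []) ∷ []
splits (n ∷ m) =
  cartesianProductWith (λ i (a , b) → (i ∷ a , (n ℕ.∸ i) ∷ b)) (upTo (suc n)) (splits m)

-- Formal power series in r commuting variables, given by their coefficients, over a
-- not necessarily commutative ring R whose elements can be divided by factorials.
module PowerSeries (R : RawSemiring a ℓ)
                   (_/!_ : RawSemiring.Carrier R → ℕ → RawSemiring.Carrier R) where

  open RawSemiring R

  Series : ℕ → Set a
  Series r = Vec ℕ r → Carrier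

  ∑ : {I : Set} → List I → (I → Carrier) → Carrier
  ∑ is x = List.foldr (λ i s → x i + s) 0# is

  constant : ∀ {r} → Carrier → Series r
  constant x []          = x
  constant x (zero  ∷ m) = constant x m
  constant x (suc _ ∷ m) = 0#

  -- The one-variable series ∑ₙ (x n) zⁿ in the variable z = zᵢ.
  inVariable : ∀ {r} → Fin r → (ℕ → Carrier) → Series r
  inVariable zero    x (n ∷ m)     = constant (x n) m
  inVariable (suc i) x (zero ∷ m)  = inVariable i x m
  inVariable (suc i) x (suc _ ∷ m) = 0#

  -- The coefficients of ∑ₖ (x k) z²ᵏ⁺¹.
  oddSeries : (ℕ → Carrier) → (ℕ → Carrier)
  oddSeries x zero          = 0#
  oddSeries x (suc zero)    = x 0
  oddSeries x (suc (suc n)) = oddSeries (x ∘ suc) n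

  _⊛_ : ∀ {r} → Series r → Series r → Series r
  (S ⊛ T) m = ∑ (splits m) λ (a , b) → S a * T b

  power : ∀ {r} → Series r → ℕ → Series r
  power S zero    = constant 1#
  power S (suc k) = S ⊛ power S k

  -- ∑ₖ Sᵏ/k!, for S without constant term: then Sᵏ has no coefficients in total
  -- degree below k, so that the terms with k > |m| do not contribute to degree m.
  exp : ∀ {r} → Series r → Series r
  exp S m = ∑ (upTo (suc (Vec.sum m))) λ k → power S k m /! k

  -- Coefficients at integer multi-indices.
  extend : ∀ {r} → Series r → (Vec ℤ r → Carrier)
  extend S []             = S []
  extend S (+ n      ∷ d) = extend (λ m → S (n ∷ m)) d
  extend S (-[1+ _ ] ∷ d) = 0#

-- Families of exponents n i j, for 1 ≤ i < j ≤ r: the row of i = 1, then the others.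
Triangle : ℕ → Set
Triangle zero    = ⊤
Triangle (suc r) = Vec ℕ r × Triangle r

-- The exponents of z₁,…,zᵣ in ∏_{i<j} (zⱼ/zᵢ)^(n i j).
exponents : ∀ {r} → Triangle r → Vec ℤ r
exponents {zero}  tt        = []
exponents {suc r} (row , n) =
  ℤ.- (+ Vec.sum row) ∷ Vec.zipWith ℤ._+_ (Vec.map +_ row) (exponents n)

module Vertex {c ℓ₁ ℓ₂} (K : HeytingField c ℓ₁ ℓ₂) (char0 : CharacteristicZero K) where

  open HeytingField K hiding (zero)
  open RawSemiringDefs (rawSemiring K) using (_^_) renaming (_×_ to _·_)

  -- The inverse of x - y.
  inverse : ∀ {x y} → x # y → Carrier
  inverse x#y = proj₁ (#⇒invertible x#y)

  fromℕ : ℕ → Carrier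
  fromℕ n = n · 1#

  1/_ : (n : ℕ) .{{_ : NonZero n}} → Carrier
  1/ suc n = inverse (char0 n)

  1/!_ : ℕ → Carrier
  1/! k = 1/_ (k !) {{k !≢0}}

  record Parameter : Set (c ⊔ ℓ₂) where
    field
      value   : Carrier
      value#1 : ∀ k → (value ^ odd k) # 1#

    -- 1 - tⁿ and its inverse, for n = 2k+1.
    1-^ : ℕ → Carrier
    1-^ k = 1# - value ^ odd k

    1/1-^ : ℕ → Carrier
    1/1-^ k = inverse (#-sym (value#1 k))

  open Parameter using (1-^; 1/1-^)

  -- The polynomial ring K[p₁,p₃,p₅,…], as the free commutative K-algebra on the
  -- generators p k, standing for p₂ₖ₊₁: expressions modulo the least congruence that
  -- makes them a commutative ring into which con is a ring homomorphism.
  infixl 7 _⊗_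
  infixl 6 _⊕_
  infix  4 _≋_

  data Γ : Set c where
    con     : Carrier → Γ
    p       : ℕ → Γ
    _⊕_ _⊗_ : Γ → Γ → Γ

  data _≋_ : Γ → Γ → Set (c ⊔ ℓ₁) where
    ≋-refl      : ∀ {f} → f ≋ f
    ≋-sym       : ∀ {f g} → f ≋ g → g ≋ f
    ≋-trans     : ∀ {f g h} → f ≋ g → g ≋ h → f ≋ h
    ⊕-cong      : ∀ {f f′ g g′} → f ≋ f′ → g ≋ g′ → f ⊕ g ≋ f′ ⊕ g′
    ⊗-cong      : ∀ {f f′ g g′} → f ≋ f′ → g ≋ g′ → f ⊗ g ≋ f′ ⊗ g′
    con-cong    : ∀ {x y} → x ≈ y → con x ≋ con y
    con-+       : ∀ x y → con (x + y) ≋ con x ⊕ con y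
    con-*       : ∀ x y → con (x * y) ≋ con x ⊗ con y
    ⊕-assoc     : ∀ f g h → (f ⊕ g) ⊕ h ≋ f ⊕ (g ⊕ h)
    ⊕-comm      : ∀ f g → f ⊕ g ≋ g ⊕ f
    ⊕-identityˡ : ∀ f → con 0# ⊕ f ≋ f
    ⊗-assoc     : ∀ f g h → (f ⊗ g) ⊗ h ≋ f ⊗ (g ⊗ h)
    ⊗-comm      : ∀ f g → f ⊗ g ≋ g ⊗ f
    ⊗-identityˡ : ∀ f → con 1# ⊗ f ≋ f
    ⊗-zeroˡ     : ∀ f → con 0# ⊗ f ≋ con 0#
    ⊗-distribˡ  : ∀ f g h → f ⊗ (g ⊕ h) ≋ f ⊗ g ⊕ f ⊗ h

  -- The partial derivative with respect to p₂ₖ₊₁.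
  ∂ : ℕ → Γ → Γ
  ∂ k (con x) = con 0#
  ∂ k (p j)   = con (if does (k ≟ j) then 1# else 0#)
  ∂ k (f ⊕ g) = ∂ k f ⊕ ∂ k g
  ∂ k (f ⊗ g) = ∂ k f ⊗ g ⊕ f ⊗ ∂ k g

  -- A family with finite support I, and its sum.
  HasSum : {I : Set} → (I → Γ) → Γ → Set (c ⊔ ℓ₁)
  HasSum {I} x s = ∃[ is ]
    Unique is × (∀ i → i ∉ is → x i ≋ con 0#) × List.foldr (λ i f → x i ⊕ f) (con 0#) is ≋ s

  Op : Set c
  Op = Γ → Γ

  infixr 8 _•_
  _•_ : Carrier → Op → Op
  (x • S) f = con x ⊗ S f

  rawOp : RawSemiring c (c ⊔ ℓ₁)
  rawOp = record
    { Carrier = Op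
    ; _≈_     = λ S T → ∀ f → S f ≋ T f
    ; _+_     = λ S T f → S f ⊕ T f
    ; _*_     = λ S T → S ∘ T
    ; 0#      = λ _ → con 0#
    ; 1#      = id
    }

  module KSeries  = PowerSeries (rawSemiring K) (λ x k → 1/! k * x)
  module OpSeries = PowerSeries rawOp (λ S k → 1/! k • S)
  open OpSeries using (Series; ∑; inVariable; oddSeries; exp; extend)

  -- a₋ k and a₊ k are a₋ₙ and aₙ for n = 2k+1.
  a₋ a₊ : ℕ → Op
  a₋ k f = p k ⊗ f
  a₊ k   = (fromℕ (odd k) * 1/ 2) • ∂ k

  -- The coefficient of zⁿ in A t is A t n; the coefficient of z⁻ⁿ in B t is B t n.
  A B : Parameter → ℕ → Op
  A t = oddSeries λ k → (fromℕ 2 * 1-^ t k * 1/ odd k) • a₋ k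
  B t = oddSeries λ k → (- (fromℕ 2 * 1/ odd k * 1/1-^ t k)) • a₊ k

  -- Formal series in z₁^±¹,…,zᵣ^±¹ with operator coefficients, which may be given by
  -- infinite sums of operators: L d f g says that the coefficient of z^d in L, applied
  -- to f, is a well-defined (locally finite) sum with value g.
  Laurent : ℕ → Set _
  Laurent r = Vec ℤ r → Γ → Γ → Set (c ⊔ ℓ₁)

  infix  4 _≐_
  infixr 5 _⊡_
  _≐_ : ∀ {r} → Laurent r → Laurent r → Set _
  L ≐ M = ∀ d f → ∃[ g ] L d f g × M d f g

  -- S(z₁,…,zᵣ) T(z₁⁻¹,…,zᵣ⁻¹).
  _⋆_ : ∀ {r} → Series r → Series r → Laurent r
  (S ⋆ T) d f = HasSum λ l → extend S (Vec.zipWith ℤ._+_ d (Vec.map +_ l)) (T l f)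

  𝒴 : Parameter → Laurent 1
  𝒴 t = exp (inVariable zero (A t)) ⋆ exp (inVariable zero (B t))

  -- 𝒴(z₁;t₁) ⋯ 𝒴(zᵣ;tᵣ), composing coefficients since the variables are distinct.
  𝒴-product : ∀ {r} → Vec Parameter r → Laurent r
  𝒴-product []       []       f g = f ≋ g
  𝒴-product (t ∷ ts) (d ∷ ds) f g = ∃[ h ] 𝒴-product ts ds f h × 𝒴 t (d ∷ []) h g

  normallyOrdered : ∀ {r} → Vec Parameter r → Laurent r
  normallyOrdered {r} ts = exp (total A) ⋆ exp (total B)
    where
    total : (Parameter → ℕ → Op) → Series r
    total C m = ∑ (allFin r) λ i → inVariable i (C (Vec.lookup ts i)) m

  F : Parameter → Parameter → ℕ → Carrier
  F t s n = KSeries.exp (KSeries.inVariable zero (KSeries.oddSeries log)) (n ∷ [])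
    where
    log : ℕ → Carrier
    log k = - (fromℕ 2 * (1-^ s k * 1/1-^ t k * 1/ odd k))

  -- The coefficient of ∏_{i<j} (zⱼ/zᵢ)^(n i j) in ∏_{i<j} F_{tᵢ,tⱼ}(zⱼ/zᵢ), where the
  -- ratios zⱼ/zᵢ are treated as independent.
  ∏F : ∀ {r} → Vec Parameter r → Triangle r → Carrier
  ∏F []       tt        = 1#
  ∏F (t ∷ ts) (row , n) =
    Vec.foldr _ _*_ 1# (Vec.zipWith (F t) ts row) * ∏F ts n

  -- The product of a series C in the ratios zⱼ/zᵢ with L.
  _⊡_ : ∀ {r} → (Triangle r → Carrier) → Laurent r → Laurent r
  _⊡_ {r} C L d f g = Σ[ h ∈ (Triangle r → Γ) ]
    (∀ n → L (Vec.zipWith ℤ._-_ d (exponents n)) f (h n)) ×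
    HasSum (λ n → con (C n) ⊗ h n) g

{-# OPTIONS --safe #-}
module Submission where

-- On the polynomial ring Γ the operator e^{A_s(w)} is multiplication by a power series,
-- while B_t(z) is a derivation that maps pₙ to a scalar multiple of z⁻ⁿ, so that e^{B_t(z)}
-- is a ring homomorphism, a translation of the generators. Hence
--
--   e^{B_t(z)} (e^{A_s(w)} f) = e^{B_t(z)}(e^{A_s(w)}) e^{B_t(z)}(f),
--   e^{B_t(z)}(e^{A_s(w)}) = e^{B_t(z) A_s(w)} e^{A_s(w)} = F_{t,s}(w/z) e^{A_s(w)},
--
-- since B_t(z) maps A_s(w) to the logarithm of F_{t,s}(w/z). Moving e^{B_t(z)} past the
-- exponentials of the other A-parts (reorder) gives the formula by induction on r
-- (product-formula).
--
-- In terms of coefficients, let E t n in Γ be the coefficient of zⁿ in e^{A_t(z)}, and let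
-- the operator D t j be that of z⁻ʲ in e^{B_t(z)}. The exponential E of a power series x
-- satisfies z E′ = (z x′) E (exp₁-derivative), and in characteristic zero this recursion
-- yields by induction on the index that D is multiplicative (D-⊗) and that
-- D t j (E s n) = F_{t,s,j} E s (n - j) (D-exp, D-Eℤ). The exponential of a sum of series in
-- distinct variables is the product of their exponentials (exp-total), by the binomial
-- theorem for divided powers.
--
-- All exponentials are computed in the commutative ring Γ. It acts on itself by
-- multiplication, and also by differential operators with constant coefficients (ρ), where
-- p₂ₖ₊₁ acts as ∂/∂p₂ₖ₊₁. The A-parts belong to the first action and the B-parts to the
-- second, and constructions on power series are compatible with both (Transfer).
--
-- The infinite sums are finite for two reasons: D t j f vanishes for j > degree f (D-degree);
-- and the A-parts have no negative powers, which bounds the exponents of the ratios zⱼ/zᵢ,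
-- because every factor z_b/z_a with a ≤ i < b lowers by one the total degree in zᵢ₊₁,…,zᵣ
-- that remains for the normally ordered product (÷-bounded). Accordingly all sums run over
-- boxes with side N, and equations between them hold for all sufficiently large N.

open import Defs
open import Algebra.Apartness.Bundles using (HeytingField)
open import Algebra.Bundles using (CommutativeMonoid; CommutativeRing; CommutativeSemiring)
open import Algebra.Bundles.Raw using (RawSemiring)
import Algebra.Properties.CommutativeMonoid.Mult as CommutativeMonoidMult
import Algebra.Properties.CommutativeSemigroup as CommutativeSemigroupProperties
import Algebra.Properties.Ring as RingProperties
import Algebra.Properties.Semiring.Mult as SemiringMult
import Algebra.Solver.Ring.NaturalCoefficients.Default as Solver
open import Data.Bool.Base using (if_then_else_)
open import Data.Fin.Base using (Fin; zero; suc)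
open import Data.Integer.Base as ℤ using (ℤ; +_; -[1+_])
import Data.Integer.Properties as ℤ
import Data.Integer.Tactic.RingSolver as ℤ-Solver
open import Data.List.Base as List using (List; []; _∷_; _++_; upTo; allFin; cartesianProductWith)
open import Data.List.Membership.Propositional using (_∈_; _∉_)
open import Data.List.Membership.Propositional.Properties using (∈-cartesianProductWith⁺; ∈-upTo⁺)
import Data.List.Properties as List
import Data.List.Relation.Unary.All as ListAll
import Data.List.Relation.Unary.AllPairs as AllPairs
open import Data.List.Relation.Unary.Any using (here)
open import Data.List.Relation.Unary.Unique.Propositional using (Unique)
open import Data.List.Relation.Unary.Unique.Propositional.Properties using (cartesianProductWith⁺; upTo⁺)
open import Data.Nat.Base as ℕ using (ℕ; zero; suc; _≤_; _<_; z≤n; s≤s; NonZero; _!)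
open import Data.Nat.Induction using (<-rec)
import Data.Nat.Properties as ℕ
open import Data.Product.Base using (_×_; _,_; proj₁; proj₂; ∃-syntax)
open import Data.Sum.Base as Sum using (_⊎_; inj₁; inj₂; [_,_]′)
open import Data.Unit.Base using (⊤; tt)
open import Data.Vec.Base as Vec using (Vec; []; _∷_)
open import Data.Vec.Relation.Unary.All as All using (All; []; _∷_)
open import Function.Base using (id; _∘_)
open import Level using (_⊔_)
open import Relation.Binary.PropositionalEquality.Core as ≡ using (_≡_; _≢_)
import Relation.Binary.Reasoning.Setoid as SetoidReasoning
open import Relation.Nullary.Decidable using (yes; no; dec-true; dec-false)
open import Relation.Nullary.Negation.Core using (contradiction)

-- Finite sums and convolutions

module FiniteSums {a ℓ} (R : CommutativeSemiring a ℓ) where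

  open CommutativeSemiring R hiding (zero)
  open SemiringMult semiring using () renaming (_×_ to _·_) public
  open SemiringMult semiring using (×-homo-+)
  open CommutativeMonoidMult +-commutativeMonoid using (×-distrib-+)
  open CommutativeSemigroupProperties (CommutativeMonoid.commutativeSemigroup +-commutativeMonoid)
    using (interchange)
  open SetoidReasoning setoid

  ∑ : {I : Set} → List I → (I → Carrier) → Carrier
  ∑ is x = List.foldr (λ i s → x i + s) 0# is

  -- Additive maps, which commute with finite sums.
  record Additive (φ : Carrier → Carrier) : Set (a ⊔ ℓ) where
    field
      homo-0 : φ 0# ≈ 0#
      homo-+ : ∀ x y → φ (x + y) ≈ φ x + φ y
  open Additive

  *ˡ-additive : ∀ x → Additive (x *_)
  *ˡ-additive x = record { homo-0 = zeroʳ x ; homo-+ = distribˡ x }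

  *ʳ-additive : ∀ x → Additive (_* x)
  *ʳ-additive x = record { homo-0 = zeroˡ x ; homo-+ = distribʳ x }

  ·-zero : ∀ n → n · 0# ≈ 0#
  ·-zero zero    = refl
  ·-zero (suc n) = trans (+-identityˡ _) (·-zero n)

  ·-additive : ∀ n → Additive (n ·_)
  ·-additive n = record { homo-0 = ·-zero n ; homo-+ = λ x y → ×-distrib-+ x y n }

  additive-· : ∀ {φ} → Additive φ → ∀ n x → φ (n · x) ≈ n · φ x
  additive-· φ+ zero    x = homo-0 φ+
  additive-· φ+ (suc n) x = trans (homo-+ φ+ x (n · x)) (+-congˡ (additive-· φ+ n x))

  module _ {I : Set} where

    ∑-cong : ∀ (is : List I) {x y} → (∀ i → x i ≈ y i) → ∑ is x ≈ ∑ is y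
    ∑-cong []       x≈y = refl
    ∑-cong (i ∷ is) x≈y = +-cong (x≈y i) (∑-cong is x≈y)

    ∑-additive : ∀ {φ} → Additive φ → ∀ (is : List I) x → φ (∑ is x) ≈ ∑ is (φ ∘ x)
    ∑-additive φ+ []       x = homo-0 φ+
    ∑-additive φ+ (i ∷ is) x = trans (homo-+ φ+ _ _) (+-congˡ (∑-additive φ+ is x))

    ∑-zero : ∀ (is : List I) {x} → (∀ i → x i ≈ 0#) → ∑ is x ≈ 0#
    ∑-zero []       x≈0 = refl
    ∑-zero (i ∷ is) x≈0 = trans (+-cong (x≈0 i) (∑-zero is x≈0)) (+-identityˡ 0#)

    ∑-+ : ∀ (is : List I) x y → ∑ is (λ i → x i + y i) ≈ ∑ is x + ∑ is y
    ∑-+ []       x y = sym (+-identityˡ 0#)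
    ∑-+ (i ∷ is) x y = trans (+-congˡ (∑-+ is x y)) (interchange (x i) (y i) _ _)

    ∑-*ˡ : ∀ y (is : List I) x → y * ∑ is x ≈ ∑ is (λ i → y * x i)
    ∑-*ˡ y = ∑-additive (*ˡ-additive y)

    ∑-*ʳ : ∀ y (is : List I) x → ∑ is x * y ≈ ∑ is (λ i → x i * y)
    ∑-*ʳ y = ∑-additive (*ʳ-additive y)

    -- If every summand is zero unless P holds, then so is the sum.
    ∑-zero-or : ∀ {q} {P : Set q} (is : List I) {x} →
                (∀ i → x i ≈ 0# ⊎ P) → ∑ is x ≈ 0# ⊎ P
    ∑-zero-or         []       x≈0 = inj₁ refl
    ∑-zero-or {P = P} (i ∷ is) {x} x≈0 = cases (x≈0 i) (∑-zero-or is x≈0)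
      where
      cases : x i ≈ 0# ⊎ P → ∑ is x ≈ 0# ⊎ P → ∑ (i ∷ is) x ≈ 0# ⊎ P
      cases (inj₁ xᵢ≈0) (inj₁ ∑≈0) = inj₁ (trans (+-cong xᵢ≈0 ∑≈0) (+-identityˡ 0#))
      cases (inj₂ pf)   _          = inj₂ pf
      cases (inj₁ _)    (inj₂ pf)  = inj₂ pf

    ∑-++ : ∀ (is js : List I) x → ∑ (is ++ js) x ≈ ∑ is x + ∑ js x
    ∑-++ []       js x = sym (+-identityˡ _)
    ∑-++ (i ∷ is) js x = trans (+-congˡ (∑-++ is js x)) (sym (+-assoc _ _ _))

  module _ {I J : Set} where

    ∑-swap : ∀ (is : List I) (js : List J) (x : I → J → Carrier) →
             ∑ is (λ i → ∑ js (λ j → x i j)) ≈ ∑ js (λ j → ∑ is (λ i → x i j))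
    ∑-swap []       js x = sym (∑-zero js (λ _ → refl))
    ∑-swap (i ∷ is) js x = trans (+-congˡ (∑-swap is js x)) (sym (∑-+ js _ _))

  ∑-map : ∀ {I J : Set} (g : I → J) is x → ∑ (List.map g is) x ≈ ∑ is (x ∘ g)
  ∑-map g []       x = refl
  ∑-map g (i ∷ is) x = +-congˡ (∑-map g is x)

  ∑-product : ∀ {I J L : Set} (g : I → J → L) is js x →
              ∑ (cartesianProductWith g is js) x ≈ ∑ is (λ i → ∑ js (λ j → x (g i j)))
  ∑-product g []       js x = refl
  ∑-product g (i ∷ is) js x =
    trans (∑-++ (List.map (g i) js) _ x) (+-cong (∑-map (g i) js x) (∑-product g is js x))

  ∑-upTo : ∀ n x → ∑ (upTo (suc n)) x ≈ x 0 + ∑ (upTo n) (x ∘ suc)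
  ∑-upTo n x = +-congˡ (trans (reflexive (≡.cong (λ is → ∑ is x) (≡.sym (List.map-upTo suc n))))
                              (∑-map suc (upTo n) x))

  ∑-extend : ∀ {m n} x → m ≤ n → (∀ i → m ≤ i → x i ≈ 0#) → ∑ (upTo n) x ≈ ∑ (upTo m) x
  ∑-extend {n = n} x z≤n x≈0 = ∑-zero (upTo n) (λ i → x≈0 i z≤n)
  ∑-extend {suc m} {suc n} x (s≤s m≤n) x≈0 = begin
    ∑ (upTo (suc n)) x           ≈⟨ ∑-upTo n x ⟩
    x 0 + ∑ (upTo n) (x ∘ suc)   ≈⟨ +-congˡ (∑-extend (x ∘ suc) m≤n (λ i → x≈0 (suc i) ∘ s≤s)) ⟩
    x 0 + ∑ (upTo m) (x ∘ suc)   ≈⟨ ∑-upTo m x ⟨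
    ∑ (upTo (suc m)) x           ∎

  opaque

    -- The sum of φ i j over all i + j = n. Opaque, so that φ is determined by conv φ n.
    conv : (ℕ → ℕ → Carrier) → ℕ → Carrier
    conv φ zero    = φ 0 0
    conv φ (suc n) = φ 0 (suc n) + conv (φ ∘ suc) n

    conv-at-0 : ∀ φ → conv φ 0 ≈ φ 0 0
    conv-at-0 φ = refl

    conv-first : ∀ φ n → conv φ (suc n) ≈ φ 0 (suc n) + conv (φ ∘ suc) n
    conv-first φ n = refl

    conv-cong : ∀ {φ ψ} n → (∀ i j → i ℕ.+ j ≡ n → φ i j ≈ ψ i j) → conv φ n ≈ conv ψ n
    conv-cong zero    φ≈ψ = φ≈ψ 0 0 ≡.refl
    conv-cong (suc n) φ≈ψ =
      +-cong (φ≈ψ 0 (suc n) ≡.refl) (conv-cong n (λ i j → φ≈ψ (suc i) j ∘ ≡.cong suc))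

    conv-cong′ : ∀ {φ ψ} n → (∀ i j → φ i j ≈ ψ i j) → conv φ n ≈ conv ψ n
    conv-cong′ n φ≈ψ = conv-cong n (λ i j _ → φ≈ψ i j)

    conv-additive : ∀ {f} → Additive f → ∀ φ n → f (conv φ n) ≈ conv (λ i j → f (φ i j)) n
    conv-additive f+ φ zero    = refl
    conv-additive f+ φ (suc n) = trans (homo-+ f+ _ _) (+-congˡ (conv-additive f+ (φ ∘ suc) n))

    conv-*ˡ : ∀ x φ n → x * conv φ n ≈ conv (λ i j → x * φ i j) n
    conv-*ˡ x = conv-additive (*ˡ-additive x)

    conv-*ʳ : ∀ x φ n → conv φ n * x ≈ conv (λ i j → φ i j * x) n
    conv-*ʳ x = conv-additive (*ʳ-additive x)

    conv-+ : ∀ φ ψ n → conv (λ i j → φ i j + ψ i j) n ≈ conv φ n + conv ψ n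
    conv-+ φ ψ zero    = refl
    conv-+ φ ψ (suc n) = trans (+-congˡ (conv-+ (φ ∘ suc) (ψ ∘ suc) n)) (interchange _ _ _ _)

    conv-zero : ∀ {φ} n → (∀ i j → i ℕ.+ j ≡ n → φ i j ≈ 0#) → conv φ n ≈ 0#
    conv-zero zero    φ≈0 = φ≈0 0 0 ≡.refl
    conv-zero (suc n) φ≈0 = trans
      (+-cong (φ≈0 0 (suc n) ≡.refl) (conv-zero n (λ i j → φ≈0 (suc i) j ∘ ≡.cong suc)))
      (+-identityˡ 0#)

    conv-head : ∀ φ n → (∀ i j → φ (suc i) j ≈ 0#) → conv φ n ≈ φ 0 n
    conv-head φ zero    φ≈0 = refl
    conv-head φ (suc n) φ≈0 = trans (+-congˡ (conv-zero n (λ i j _ → φ≈0 i j))) (+-identityʳ _)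

    conv-∑ : ∀ {I : Set} (is : List I) (φ : ℕ → ℕ → I → Carrier) n →
             conv (λ i j → ∑ is (φ i j)) n ≈ ∑ is (λ k → conv (λ i j → φ i j k) n)
    conv-∑ is φ zero    = refl
    conv-∑ is φ (suc n) = trans (+-congˡ (conv-∑ is (φ ∘ suc) n)) (sym (∑-+ is _ _))

    conv-exchange : ∀ (φ : ℕ → ℕ → ℕ → ℕ → Carrier) n m →
                    conv (λ i j → conv (φ i j) m) n ≈ conv (λ a b → conv (λ i j → φ i j a b) n) m
    conv-exchange φ zero    m = refl
    conv-exchange φ (suc n) m =
      trans (+-congˡ (conv-exchange (φ ∘ suc) n m)) (sym (conv-+ _ _ m))

    conv-last : ∀ φ n → conv φ (suc n) ≈ conv (λ i j → φ i (suc j)) n + φ (suc n) 0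
    conv-last φ zero    = refl
    conv-last φ (suc n) = trans (+-congˡ (conv-last (φ ∘ suc) n)) (sym (+-assoc _ _ _))

    conv-comm : ∀ φ n → conv φ n ≈ conv (λ i j → φ j i) n
    conv-comm φ zero    = refl
    conv-comm φ (suc n) = begin
      φ 0 (suc n) + conv (φ ∘ suc) n                   ≈⟨ +-comm _ _ ⟩
      conv (φ ∘ suc) n + φ 0 (suc n)                   ≈⟨ +-congʳ (conv-comm (φ ∘ suc) n) ⟩
      conv (λ i j → φ (suc j) i) n + φ 0 (suc n)       ≈⟨ conv-last (λ i j → φ j i) n ⟨
      conv (λ i j → φ j i) (suc n)                     ∎

    conv-assoc : ∀ (φ : ℕ → ℕ → ℕ → Carrier) n → conv (λ i l → conv (λ j k → φ i j k) l) n ≈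
                         conv (λ h k → conv (λ i j → φ i j k) h) n
    conv-assoc φ zero    = refl
    conv-assoc φ (suc n) = begin
      (φ 0 0 (suc n) + conv (λ j k → φ 0 (suc j) k) n) + conv (λ i l → conv (φ (suc i)) l) n
        ≈⟨ +-congˡ (conv-assoc (φ ∘ suc) n) ⟩
      (φ 0 0 (suc n) + conv (λ j k → φ 0 (suc j) k) n) +
        conv (λ h k → conv (λ i j → φ (suc i) j k) h) n
        ≈⟨ +-assoc _ _ _ ⟩
      φ 0 0 (suc n) + (conv (λ j k → φ 0 (suc j) k) n +
        conv (λ h k → conv (λ i j → φ (suc i) j k) h) n)
        ≈⟨ +-congˡ (conv-+ _ _ n) ⟨
      φ 0 0 (suc n) + conv (λ h k → φ 0 (suc h) k + conv (λ i j → φ (suc i) j k) h) n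
        ∎

    conv-swap : ∀ (φ : ℕ → ℕ → ℕ → Carrier) n → conv (λ i l → conv (λ j k → φ i j k) l) n ≈
                        conv (λ j l → conv (λ i k → φ i j k) l) n
    conv-swap φ n = begin
      conv (λ i l → conv (λ j k → φ i j k) l) n   ≈⟨ conv-assoc φ n ⟩
      conv (λ h k → conv (λ i j → φ i j k) h) n   ≈⟨ conv-cong′ n (λ h k → conv-comm (λ i j → φ i j k) h) ⟩
      conv (λ h k → conv (λ j i → φ i j k) h) n   ≈⟨ conv-assoc (λ j i k → φ i j k) n ⟨
      conv (λ j l → conv (λ i k → φ i j k) l) n   ∎

    -- The product rule for z d/dz.
    conv-Leibniz : ∀ φ n →
      n · conv φ n ≈ conv (λ i j → i · φ i j) n + conv (λ i j → j · φ i j) n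
    conv-Leibniz φ n = begin
      n · conv φ n                                 ≈⟨ conv-additive (·-additive n) φ n ⟩
      conv (λ i j → n · φ i j) n                   ≈⟨ conv-cong n weight ⟩
      conv (λ i j → i · φ i j + j · φ i j) n       ≈⟨ conv-+ _ _ n ⟩
      conv (λ i j → i · φ i j) n + conv (λ i j → j · φ i j) n  ∎
      where
      weight : ∀ i j → i ℕ.+ j ≡ n → n · φ i j ≈ i · φ i j + j · φ i j
      weight i j ≡.refl = ×-homo-+ (φ i j) i j

    conv-Leibniz-suc : ∀ φ n → suc n · conv φ (suc n) ≈
      conv (λ i j → suc i · φ (suc i) j) n + conv (λ i j → suc j · φ i (suc j)) n
    conv-Leibniz-suc φ n = trans (conv-Leibniz φ (suc n)) (+-cong
      (+-identityˡ _) (trans (conv-last (λ i j → j · φ i j) n) (+-identityʳ _)))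

    ∑-antidiagonal : ∀ φ n → ∑ (upTo (suc n)) (λ i → φ i (n ℕ.∸ i)) ≈ conv φ n
    ∑-antidiagonal φ zero    = +-identityʳ (φ 0 0)
    ∑-antidiagonal φ (suc n) =
      trans (∑-upTo (suc n) _) (+-congˡ (∑-antidiagonal (φ ∘ suc) n))

    ∑-conv-suc : ∀ φ n → ∑ (upTo (suc n)) (conv φ) ≈
                         ∑ (upTo (suc n)) (φ 0) + ∑ (upTo n) (conv (φ ∘ suc))
    ∑-conv-suc φ n = begin
      ∑ (upTo (suc n)) (conv φ)                                       ≈⟨ ∑-upTo n (conv φ) ⟩
      φ 0 0 + ∑ (upTo n) (λ k → φ 0 (suc k) + conv (φ ∘ suc) k)       ≈⟨ +-congˡ (∑-+ (upTo n) _ _) ⟩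
      φ 0 0 + (∑ (upTo n) (φ 0 ∘ suc) + ∑ (upTo n) (conv (φ ∘ suc)))  ≈⟨ +-assoc _ _ _ ⟨
      φ 0 0 + ∑ (upTo n) (φ 0 ∘ suc) + ∑ (upTo n) (conv (φ ∘ suc))    ≈⟨ +-congʳ (∑-upTo n (φ 0)) ⟨
      ∑ (upTo (suc n)) (φ 0) + ∑ (upTo n) (conv (φ ∘ suc))            ∎

  -- A family supported in the rectangle [0,m) × [0,n), summed by antidiagonals. The last
  -- antidiagonal that meets the rectangle is i + j = m + n - 2, whence the bound on N.
  ∑-conv : ∀ φ m n {N} → m ℕ.+ n ≤ suc N →
           (∀ i j → m ≤ i → φ i j ≈ 0#) → (∀ i j → n ≤ j → φ i j ≈ 0#) →
           ∑ (upTo N) (conv φ) ≈ ∑ (upTo m) (λ i → ∑ (upTo n) (φ i))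
  ∑-conv φ zero    n {N}     _          φ≈0 _   =
    ∑-zero (upTo N) (λ k → conv-zero k (λ i j _ → φ≈0 i j z≤n))
  ∑-conv φ (suc m) n {zero}  (s≤s m+n≤0) _   _  with ≡.refl ← ℕ.m+n≡0⇒n≡0 m (ℕ.n≤0⇒n≡0 m+n≤0) =
    sym (∑-zero (upTo (suc m)) (λ _ → refl))
  ∑-conv φ (suc m) n {suc N} (s≤s m+n≤N) φ≈0 φ≈0′ = begin
    ∑ (upTo (suc N)) (conv φ)
      ≈⟨ ∑-conv-suc φ N ⟩
    ∑ (upTo (suc N)) (φ 0) + ∑ (upTo N) (conv (φ ∘ suc))
      ≈⟨ +-cong (∑-extend (φ 0) (ℕ.≤-trans (ℕ.m≤n+m n m) m+n≤N) (φ≈0′ 0))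
                (∑-conv (φ ∘ suc) m n m+n≤N (λ i j → φ≈0 (suc i) j ∘ s≤s) (φ≈0′ ∘ suc)) ⟩
    ∑ (upTo n) (φ 0) + ∑ (upTo m) (λ i → ∑ (upTo n) (φ (suc i)))
      ≈⟨ ∑-upTo m _ ⟨
    ∑ (upTo (suc m)) (λ i → ∑ (upTo n) (φ i))
      ∎

module Shift {a ℓ} (R : CommutativeSemiring a ℓ) where

  open CommutativeSemiring R hiding (zero)
  open FiniteSums R
  open SetoidReasoning setoid

  -- The coefficients of zᵃ ∑ₙ (x n) zⁿ.
  shift : ℕ → (ℕ → Carrier) → ℕ → Carrier
  shift zero    x n       = x n
  shift (suc a) x zero    = 0#
  shift (suc a) x (suc n) = shift a x n

  shift-cong : ∀ a {x y} n → (∀ n → x n ≈ y n) → shift a x n ≈ shift a y n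
  shift-cong zero    n       x≈y = x≈y n
  shift-cong (suc a) zero    x≈y = refl
  shift-cong (suc a) (suc n) x≈y = shift-cong a n x≈y

  conv-shift : ∀ a (y x : ℕ → Carrier) n →
               conv (λ i j → y i * shift a x j) n ≈ shift a (conv (λ i j → y i * x j)) n
  conv-shift zero    y x n       = refl
  conv-shift (suc a) y x zero    = trans (conv-at-0 _) (zeroʳ _)
  conv-shift (suc a) y x (suc n) = begin
    conv (λ i j → y i * shift (suc a) x j) (suc n)              ≈⟨ conv-last (λ i j → y i * shift (suc a) x j) n ⟩
    conv (λ i j → y i * shift a x j) n + y (suc n) * 0#         ≈⟨ +-cong (conv-shift a y x n) (zeroʳ _) ⟩
    shift a (conv (λ i j → y i * x j)) n + 0#                   ≈⟨ +-identityʳ _ ⟩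
    shift a (conv (λ i j → y i * x j)) n                        ∎

  -- The product of a monomial with y a as its coefficient and a series.
  conv-single : ∀ a {y : ℕ → Carrier} (x : ℕ → Carrier) n → (∀ i → a ≢ i → y i ≈ 0#) →
                conv (λ i j → y i * x j) n ≈ y a * shift a x n
  conv-single zero    x n       y≈0 =
    conv-head _ n (λ i j → trans (*-congʳ (y≈0 (suc i) λ ())) (zeroˡ _))
  conv-single (suc a) x zero    y≈0 = trans (conv-at-0 _)
    (trans (*-congʳ (y≈0 0 λ ())) (trans (zeroˡ _) (sym (zeroʳ _))))
  conv-single (suc a) x (suc n) y≈0 = trans (conv-first _ n) (trans
    (+-cong (trans (*-congʳ (y≈0 0 λ ())) (zeroˡ _))
            (conv-single a x n (λ i a≢i → y≈0 (suc i) (a≢i ∘ ℕ.suc-injective))))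
    (+-identityˡ _))

  -- The product rule for z d/dz and zᵃ x(z).
  shift-Leibniz : ∀ a x n → n · shift a x n ≈ a · shift a x n + shift a (λ k → k · x k) n
  shift-Leibniz zero    x n       = sym (+-identityˡ _)
  shift-Leibniz (suc a) x zero    = sym (trans (+-identityʳ _) (·-zero (suc a)))
  shift-Leibniz (suc a) x (suc n) =
    trans (+-congˡ (shift-Leibniz a x n)) (sym (+-assoc _ _ _))

-- Exponentials of power series

-- Commutative semirings in which natural numbers are cancellable and factorials are
-- invertible; inv! k is the inverse of k!.
record FactorialInverses {a ℓ} (R : CommutativeSemiring a ℓ) : Set (a ⊔ ℓ) where

  open CommutativeSemiring R hiding (zero)
  open SemiringMult semiring using () renaming (_×_ to _·_)

  field
    cancel   : ∀ n {x y} → suc n · x ≈ suc n · y → x ≈ y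
    inv!     : ℕ → Carrier
    inv!-0   : inv! 0 ≈ 1#
    inv!-suc : ∀ k → suc k · inv! (suc k) ≈ inv! k

module Exponentials {a ℓ} (R : CommutativeSemiring a ℓ) (inverses : FactorialInverses R) where

  open CommutativeSemiring R hiding (zero)
  open FactorialInverses inverses
  open FiniteSums R hiding (∑)
  open SemiringMult semiring using (×-congʳ; ×-assoc-*; ×-comm-*)
  open CommutativeSemigroupProperties *-commutativeSemigroup
    using (x∙yz≈y∙xz)
  open SetoidReasoning setoid
  open PowerSeries (CommutativeSemiring.rawSemiring R) (λ x k → inv! k * x)

  ⊛-cong : ∀ {r} {S S′ T T′ : Series r} → (∀ m → S m ≈ S′ m) → (∀ m → T m ≈ T′ m) →
           ∀ m → (S ⊛ T) m ≈ (S′ ⊛ T′) m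
  ⊛-cong S≈S′ T≈T′ m = ∑-cong (splits m) (λ (i , j) → *-cong (S≈S′ i) (T≈T′ j))

  ⊛-∷ : ∀ {r} (S T : Series (suc r)) n m →
        (S ⊛ T) (n ∷ m) ≈ conv (λ i j → ((S ∘ (i ∷_)) ⊛ (T ∘ (j ∷_))) m) n
  ⊛-∷ S T n m = trans
    (∑-product (λ i (a , b) → (i ∷ a , (n ℕ.∸ i) ∷ b)) (upTo (suc n)) (splits m) _)
    (∑-antidiagonal (λ i j → ((S ∘ (i ∷_)) ⊛ (T ∘ (j ∷_))) m) n)

  ⊛-distribʳ : ∀ {r} (S S′ T : Series r) m → ((λ a → S a + S′ a) ⊛ T) m ≈ (S ⊛ T) m + (S′ ⊛ T) m
  ⊛-distribʳ S S′ T m =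
    trans (∑-cong (splits m) (λ (i , j) → distribʳ _ _ _)) (∑-+ (splits m) _ _)

  ⊛-zeroˡ : ∀ {r} {S : Series r} T m → (∀ m → S m ≈ 0#) → (S ⊛ T) m ≈ 0#
  ⊛-zeroˡ T m S≈0 = ∑-zero (splits m) (λ (i , j) → trans (*-congʳ (S≈0 i)) (zeroˡ _))

  ⊛-*ʳ : ∀ {r} (S T : Series r) y m → (S ⊛ (λ b → y * T b)) m ≈ y * (S ⊛ T) m
  ⊛-*ʳ S T y m = trans (∑-cong (splits m) (λ (i , j) → x∙yz≈y∙xz _ _ _)) (sym (∑-*ˡ y (splits m) _))

  ⊛-convʳ : ∀ {r} (S : Series r) (T : ℕ → ℕ → Series r) k m →
            (S ⊛ (λ b → conv (λ i j → T i j b) k)) m ≈ conv (λ i j → (S ⊛ T i j) m) k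
  ⊛-convʳ S T k m =
    trans (∑-cong (splits m) (λ (i , j) → conv-*ˡ _ _ k)) (sym (conv-∑ (splits m) _ k))

  constant-⊛ : ∀ {r} x (T : Series r) m → (constant x ⊛ T) m ≈ x * T m
  constant-⊛ x T []      = +-identityʳ _
  constant-⊛ x T (n ∷ m) = begin
    (constant x ⊛ T) (n ∷ m)
      ≈⟨ ⊛-∷ (constant x) T n m ⟩
    conv (λ i j → ((constant x ∘ (i ∷_)) ⊛ (T ∘ (j ∷_))) m) n
      ≈⟨ conv-head _ n (λ i j → ⊛-zeroˡ _ m (λ _ → refl)) ⟩
    (constant x ⊛ (T ∘ (n ∷_))) m
      ≈⟨ constant-⊛ x (T ∘ (n ∷_)) m ⟩
    x * T (n ∷ m)
      ∎

  -- A series in z₂, z₃, … as a series in z₁, z₂, ….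
  weaken : ∀ {r} → Series r → Series (suc r)
  weaken T (zero  ∷ m) = T m
  weaken T (suc _ ∷ m) = 0#

  weaken-⊛ : ∀ {r} (T : Series r) U n m → (weaken T ⊛ U) (n ∷ m) ≈ (T ⊛ (U ∘ (n ∷_))) m
  weaken-⊛ T U n m = trans (⊛-∷ (weaken T) U n m)
    (conv-head _ n (λ i j → ⊛-zeroˡ _ m (λ _ → refl)))

  inVariable-⊛ : ∀ {r} x (U : Series (suc r)) n m →
                 (inVariable zero x ⊛ U) (n ∷ m) ≈ conv (λ i j → x i * U (j ∷ m)) n
  inVariable-⊛ x U n m = trans (⊛-∷ (inVariable zero x) U n m)
    (conv-cong′ n (λ i j → constant-⊛ (x i) (U ∘ (j ∷_)) m))

  -- The powers, the divided powers and the exponential of the one-variable series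
  -- ∑ₙ (x n) zⁿ, given by their coefficients. The exponential is opaque, as it is determined
  -- by its initial value and its differential equation.
  power₁ : (ℕ → Carrier) → ℕ → ℕ → Carrier
  power₁ x k n = power (inVariable zero x) k (n ∷ [])

  dividedPower₁ : (ℕ → Carrier) → ℕ → ℕ → Carrier
  dividedPower₁ x k n = inv! k * power₁ x k n

  opaque

    exp₁ : (ℕ → Carrier) → ℕ → Carrier
    exp₁ x n = exp (inVariable zero x) (n ∷ [])

    exp₁-def : ∀ x n → exp (inVariable zero x) (n ∷ []) ≈ exp₁ x n
    exp₁-def x n = refl

  -- The divided power Sᵏ/k! of a series in several variables.
  dividedPower : ∀ {r} → Series r → ℕ → Series r
  dividedPower S k m = inv! k * power S k m

  power₁-suc : ∀ x k n → power₁ x (suc k) n ≈ conv (λ i j → x i * power₁ x k j) n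
  power₁-suc x k n = inVariable-⊛ x (power (inVariable zero x) k) n []

  dividedPower₁-suc : ∀ x k n →
    suc k · dividedPower₁ x (suc k) n ≈ conv (λ i j → x i * dividedPower₁ x k j) n
  dividedPower₁-suc x k n = begin
    suc k · (inv! (suc k) * power₁ x (suc k) n)         ≈⟨ ×-assoc-* (suc k) _ _ ⟨
    (suc k · inv! (suc k)) * power₁ x (suc k) n         ≈⟨ *-cong (inv!-suc k) (power₁-suc x k n) ⟩
    inv! k * conv (λ i j → x i * power₁ x k j) n        ≈⟨ conv-*ˡ _ _ n ⟩
    conv (λ i j → inv! k * (x i * power₁ x k j)) n      ≈⟨ conv-cong′ n (λ i j → x∙yz≈y∙xz _ _ _) ⟩
    conv (λ i j → x i * dividedPower₁ x k j) n          ∎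

  dividedPower-suc : ∀ {r} (S : Series r) k m →
    suc k · dividedPower S (suc k) m ≈ (S ⊛ dividedPower S k) m
  dividedPower-suc S k m = begin
    suc k · (inv! (suc k) * (S ⊛ power S k) m)          ≈⟨ ×-assoc-* (suc k) _ _ ⟨
    (suc k · inv! (suc k)) * (S ⊛ power S k) m          ≈⟨ *-congʳ (inv!-suc k) ⟩
    inv! k * (S ⊛ power S k) m                          ≈⟨ ⊛-*ʳ S (power S k) (inv! k) m ⟨
    (S ⊛ dividedPower S k) m                            ∎

  dividedPower₁-0 : ∀ x n → dividedPower₁ x 0 (suc n) ≈ 0#
  dividedPower₁-0 x n = zeroʳ _

  power₁-vanishes : ∀ x → x 0 ≈ 0# → ∀ k n → n < k → power₁ x k n ≈ 0#
  power₁-vanishes x x₀≈0 (suc k) n (s≤s n≤k) = trans (power₁-suc x k n) (conv-zero n summand)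
    where
    summand : ∀ i j → i ℕ.+ j ≡ n → x i * power₁ x k j ≈ 0#
    summand zero    j _      = trans (*-congʳ x₀≈0) (zeroˡ _)
    summand (suc i) j ≡.refl = trans
      (*-congˡ (power₁-vanishes x x₀≈0 k j (ℕ.≤-trans (s≤s (ℕ.m≤n+m j i)) n≤k))) (zeroʳ _)

  dividedPower₁-vanishes : ∀ x → x 0 ≈ 0# → ∀ k n → n < k → dividedPower₁ x k n ≈ 0#
  dividedPower₁-vanishes x x₀≈0 k n n<k =
    trans (*-congˡ (power₁-vanishes x x₀≈0 k n n<k)) (zeroʳ _)

  exp₁-truncate : ∀ x → x 0 ≈ 0# → ∀ {n N} → n < N →
                  exp₁ x n ≈ ∑ (upTo N) (λ k → dividedPower₁ x k n)
  exp₁-truncate x x₀≈0 {n} {N} n<N = begin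
    exp₁ x n
      ≈⟨ exp₁-def x n ⟨
    ∑ (upTo (suc (n ℕ.+ 0))) (λ k → dividedPower₁ x k n)
      ≡⟨ ≡.cong (λ d → ∑ (upTo (suc d)) (λ k → dividedPower₁ x k n)) (ℕ.+-identityʳ n) ⟩
    ∑ (upTo (suc n)) (λ k → dividedPower₁ x k n)
      ≈⟨ ∑-extend _ n<N (λ k → dividedPower₁-vanishes x x₀≈0 k n) ⟨
    ∑ (upTo N) (λ k → dividedPower₁ x k n)
      ∎

  exp₁-0 : ∀ x → x 0 ≈ 0# → exp₁ x 0 ≈ 1#
  exp₁-0 x x₀≈0 = begin
    exp₁ x 0           ≈⟨ exp₁-def x 0 ⟨
    inv! 0 * 1# + 0#   ≈⟨ +-identityʳ _ ⟩
    inv! 0 * 1#        ≈⟨ *-identityʳ _ ⟩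
    inv! 0             ≈⟨ inv!-0 ⟩
    1#                 ∎

  -- z d/dz of a power.
  power₁-derivative : ∀ x k n → n · power₁ x (suc k) n ≈
                      suc k · conv (λ i j → (i · x i) * power₁ x k j) n
  power₁-derivative x k n = begin
    n · power₁ x (suc k) n
      ≈⟨ ×-congʳ n (power₁-suc x k n) ⟩
    n · conv (λ i j → x i * power₁ x k j) n
      ≈⟨ conv-Leibniz (λ i j → x i * power₁ x k j) n ⟩
    conv (λ i j → i · (x i * power₁ x k j)) n + conv (λ i j → j · (x i * power₁ x k j)) n
      ≈⟨ +-cong (conv-cong′ n (λ i j → sym (×-assoc-* i _ _)))
                (trans (conv-cong′ n (λ i j → sym (×-comm-* j _ _))) (rest k)) ⟩
    suc k · conv (λ i j → (i · x i) * power₁ x k j) n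
      ∎
    where
    rest : ∀ k → conv (λ i j → x i * (j · power₁ x k j)) n ≈
                 k · conv (λ i j → (i · x i) * power₁ x k j) n
    rest zero    = conv-zero n (λ i j _ → trans (*-congˡ (unit j)) (zeroʳ _))
      where
      unit : ∀ j → j · power₁ x 0 j ≈ 0#
      unit zero    = refl
      unit (suc j) = ·-zero (suc j)
    rest (suc k) = begin
      conv (λ i j → x i * (j · power₁ x (suc k) j)) n
        ≈⟨ conv-cong′ n (λ i j → *-congˡ (power₁-derivative x k j)) ⟩
      conv (λ i j → x i * (suc k · conv (λ a b → (a · x a) * power₁ x k b) j)) n
        ≈⟨ conv-cong′ n (λ i j → ×-comm-* (suc k) _ _) ⟩
      conv (λ i j → suc k · (x i * conv (λ a b → (a · x a) * power₁ x k b) j)) n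
        ≈⟨ conv-additive (·-additive (suc k)) _ n ⟨
      suc k · conv (λ i j → x i * conv (λ a b → (a · x a) * power₁ x k b) j) n
        ≈⟨ ×-congʳ (suc k) (conv-cong′ n (λ i j → conv-*ˡ _ _ j)) ⟩
      suc k · conv (λ i j → conv (λ a b → x i * ((a · x a) * power₁ x k b)) j) n
        ≈⟨ ×-congʳ (suc k) (conv-swap (λ i a b → x i * ((a · x a) * power₁ x k b)) n) ⟩
      suc k · conv (λ a j → conv (λ i b → x i * ((a · x a) * power₁ x k b)) j) n
        ≈⟨ ×-congʳ (suc k) (conv-cong′ n (λ a j → conv-cong′ j (λ i b → x∙yz≈y∙xz _ _ _))) ⟩
      suc k · conv (λ a j → conv (λ i b → (a · x a) * (x i * power₁ x k b)) j) n
        ≈⟨ ×-congʳ (suc k) (conv-cong′ n (λ a j → sym (conv-*ˡ _ _ j))) ⟩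
      suc k · conv (λ a j → (a · x a) * conv (λ i b → x i * power₁ x k b) j) n
        ≈⟨ ×-congʳ (suc k) (conv-cong′ n (λ a j → *-congˡ (sym (power₁-suc x k j)))) ⟩
      suc k · conv (λ a j → (a · x a) * power₁ x (suc k) j) n
        ∎

  dividedPower₁-derivative : ∀ x k n → n · dividedPower₁ x (suc k) n ≈
                             conv (λ i j → (i · x i) * dividedPower₁ x k j) n
  dividedPower₁-derivative x k n = begin
    n · (inv! (suc k) * power₁ x (suc k) n)
      ≈⟨ ×-comm-* n _ _ ⟨
    inv! (suc k) * (n · power₁ x (suc k) n)
      ≈⟨ *-congˡ (power₁-derivative x k n) ⟩
    inv! (suc k) * (suc k · conv (λ i j → (i · x i) * power₁ x k j) n)
      ≈⟨ trans (×-comm-* (suc k) _ _) (sym (×-assoc-* (suc k) _ _)) ⟩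
    (suc k · inv! (suc k)) * conv (λ i j → (i · x i) * power₁ x k j) n
      ≈⟨ *-congʳ (inv!-suc k) ⟩
    inv! k * conv (λ i j → (i · x i) * power₁ x k j) n
      ≈⟨ trans (conv-*ˡ _ _ n) (conv-cong′ n (λ i j → x∙yz≈y∙xz _ _ _)) ⟩
    conv (λ i j → (i · x i) * dividedPower₁ x k j) n
      ∎

  -- The differential equation z E′ = (z x′) E of E = exp x; with E(0) = 1 it determines E.
  exp₁-derivative : ∀ x → x 0 ≈ 0# → ∀ n →
                    n · exp₁ x n ≈ conv (λ i j → (i · x i) * exp₁ x j) n
  exp₁-derivative x x₀≈0 n = begin
    n · exp₁ x n
      ≈⟨ ×-congʳ n (exp₁-truncate x x₀≈0 (ℕ.m<n⇒m<1+n (ℕ.n<1+n n))) ⟩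
    n · ∑ (upTo (suc (suc n))) (λ k → dividedPower₁ x k n)
      ≈⟨ ∑-additive (·-additive n) (upTo (suc (suc n))) _ ⟩
    ∑ (upTo (suc (suc n))) (λ k → n · dividedPower₁ x k n)
      ≈⟨ ∑-upTo (suc n) _ ⟩
    n · dividedPower₁ x 0 n + ∑ (upTo (suc n)) (λ k → n · dividedPower₁ x (suc k) n)
      ≈⟨ +-cong (unit n) (∑-cong (upTo (suc n)) (λ k → dividedPower₁-derivative x k n)) ⟩
    0# + ∑ (upTo (suc n)) (λ k → conv (λ i j → (i · x i) * dividedPower₁ x k j) n)
      ≈⟨ +-identityˡ _ ⟩
    ∑ (upTo (suc n)) (λ k → conv (λ i j → (i · x i) * dividedPower₁ x k j) n)
      ≈⟨ conv-∑ (upTo (suc n)) _ n ⟨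
    conv (λ i j → ∑ (upTo (suc n)) (λ k → (i · x i) * dividedPower₁ x k j)) n
      ≈⟨ conv-cong n (λ i j i+j≡n → trans (sym (∑-*ˡ _ (upTo (suc n)) _))
           (*-congˡ (sym (exp₁-truncate x x₀≈0 (s≤s (ℕ.≤-trans (ℕ.m≤n+m j i) (ℕ.≤-reflexive i+j≡n))))))) ⟩
    conv (λ i j → (i · x i) * exp₁ x j) n
      ∎
    where
    unit : ∀ n → n · dividedPower₁ x 0 n ≈ 0#
    unit zero    = refl
    unit (suc n) = trans (×-congʳ (suc n) (dividedPower₁-0 x n)) (·-zero (suc n))

  -- The sum of one-variable series x i in distinct variables zᵢ.
  total : ∀ {r} → (Fin r → ℕ → Carrier) → Series r
  total {r} x m = ∑ (allFin r) λ i → inVariable i (x i) m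

  total-suc : ∀ {r} (x : Fin (suc r) → ℕ → Carrier) m →
              total x m ≈ inVariable zero (x zero) m + weaken (total (x ∘ suc)) m
  total-suc {r} x (n ∷ m) = +-congˡ (begin
    ∑ (List.tabulate suc) (λ i → inVariable i (x i) (n ∷ m))
      ≡⟨ ≡.cong (λ is → ∑ is (λ i → inVariable i (x i) (n ∷ m))) (List.map-tabulate id suc) ⟨
    ∑ (List.map suc (allFin r)) (λ i → inVariable i (x i) (n ∷ m))
      ≈⟨ ∑-map suc (allFin r) _ ⟩
    ∑ (allFin r) (λ i → inVariable (suc i) (x (suc i)) (n ∷ m))
      ≈⟨ later n ⟩
    weaken (total (x ∘ suc)) (n ∷ m)
      ∎)
    where
    later : ∀ n → ∑ (allFin r) (λ i → inVariable (suc i) (x (suc i)) (n ∷ m)) ≈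
                  weaken (total (x ∘ suc)) (n ∷ m)
    later zero    = refl
    later (suc n) = ∑-zero (allFin r) (λ _ → refl)

  -- The binomial theorem for divided powers of the sum of x zero and total (x ∘ suc). By
  -- induction: multiplication of dividedPower S k by S gives k+1 times the next one.
  dividedPower-total : ∀ {r} (x : Fin (suc r) → ℕ → Carrier) k n m →
    dividedPower (total x) k (n ∷ m) ≈
    conv (λ a b → dividedPower₁ (x zero) a n * dividedPower (total (x ∘ suc)) b m) k
  dividedPower-total x zero zero    m = begin
    inv! 0 * constant 1# m                  ≈⟨ *-identityˡ _ ⟨
    1# * (inv! 0 * constant 1# m)           ≈⟨ *-congʳ (trans (*-identityʳ _) inv!-0) ⟨
    (inv! 0 * 1#) * (inv! 0 * constant 1# m)  ≈⟨ conv-at-0 _ ⟨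
    conv (λ a b → dividedPower₁ (x zero) a 0 * dividedPower (total (x ∘ suc)) b m) 0  ∎
  dividedPower-total x zero (suc n) m =
    trans (zeroʳ _) (sym (trans (conv-at-0 _) (trans (*-congʳ (zeroʳ _)) (zeroˡ _))))
  dividedPower-total x (suc k) n m = cancel k (begin
    suc k · P (suc k) (n ∷ m)
      ≈⟨ dividedPower-suc (total x) k (n ∷ m) ⟩
    (total x ⊛ P k) (n ∷ m)
      ≈⟨ ⊛-cong {T = P k} (total-suc x) (λ _ → refl) (n ∷ m) ⟩
    ((λ m → X m + weaken (total (x ∘ suc)) m) ⊛ P k) (n ∷ m)
      ≈⟨ ⊛-distribʳ X (weaken (total (x ∘ suc))) (P k) (n ∷ m) ⟩
    (X ⊛ P k) (n ∷ m) + (weaken (total (x ∘ suc)) ⊛ P k) (n ∷ m)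
      ≈⟨ +-cong (inVariable-⊛ (x zero) (P k) n m) (weaken-⊛ (total (x ∘ suc)) (P k) n m) ⟩
    conv (λ i j → x zero i * P k (j ∷ m)) n + (total (x ∘ suc) ⊛ (P k ∘ (n ∷_))) m
      ≈⟨ +-cong first others ⟩
    conv (λ a b → suc a · (p (suc a) n * Q b m)) k + conv (λ a b → suc b · (p a n * Q (suc b) m)) k
      ≈⟨ conv-Leibniz-suc (λ a b → p a n * Q b m) k ⟨
    suc k · conv (λ a b → p a n * Q b m) (suc k)
      ∎)
    where
    X = inVariable zero (x zero)
    P = dividedPower (total x)
    p = dividedPower₁ (x zero)
    Q = dividedPower (total (x ∘ suc))

    first : conv (λ i j → x zero i * P k (j ∷ m)) n ≈
            conv (λ a b → suc a · (p (suc a) n * Q b m)) k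
    first = begin
      conv (λ i j → x zero i * P k (j ∷ m)) n
        ≈⟨ conv-cong′ n (λ i j → trans (*-congˡ (dividedPower-total x k j m)) (conv-*ˡ _ _ k)) ⟩
      conv (λ i j → conv (λ a b → x zero i * (p a j * Q b m)) k) n
        ≈⟨ conv-exchange _ n k ⟩
      conv (λ a b → conv (λ i j → x zero i * (p a j * Q b m)) n) k
        ≈⟨ conv-cong′ k (λ a b → trans (conv-cong′ n (λ i j → sym (*-assoc _ _ _)))
                                       (sym (conv-*ʳ _ _ n))) ⟩
      conv (λ a b → conv (λ i j → x zero i * p a j) n * Q b m) k
        ≈⟨ conv-cong′ k (λ a b → *-congʳ (sym (dividedPower₁-suc (x zero) a n))) ⟩
      conv (λ a b → (suc a · p (suc a) n) * Q b m) k
        ≈⟨ conv-cong′ k (λ a b → ×-assoc-* (suc a) _ _) ⟩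
      conv (λ a b → suc a · (p (suc a) n * Q b m)) k
        ∎

    others : (total (x ∘ suc) ⊛ (P k ∘ (n ∷_))) m ≈
             conv (λ a b → suc b · (p a n * Q (suc b) m)) k
    others = begin
      (total (x ∘ suc) ⊛ (P k ∘ (n ∷_))) m
        ≈⟨ ⊛-cong {S = total (x ∘ suc)} (λ _ → refl) (dividedPower-total x k n) m ⟩
      (total (x ∘ suc) ⊛ (λ m → conv (λ a b → p a n * Q b m) k)) m
        ≈⟨ ⊛-convʳ (total (x ∘ suc)) (λ a b m → p a n * Q b m) k m ⟩
      conv (λ a b → (total (x ∘ suc) ⊛ (λ m → p a n * Q b m)) m) k
        ≈⟨ conv-cong′ k (λ a b → trans (⊛-*ʳ (total (x ∘ suc)) (Q b) _ m)
             (trans (*-congˡ (sym (dividedPower-suc (total (x ∘ suc)) b m))) (×-comm-* (suc b) _ _))) ⟩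
      conv (λ a b → suc b · (p a n * Q (suc b) m)) k
        ∎

  -- Series without constant terms have no coefficients of total degree below k in Sᵏ/k!.
  dividedPower-vanishes : ∀ {r} (x : Fin r → ℕ → Carrier) → (∀ i → x i 0 ≈ 0#) →
    ∀ k m → Vec.sum m < k → dividedPower (total x) k m ≈ 0#
  dividedPower-vanishes x x₀≈0 (suc k) []      _       =
    trans (*-congˡ (trans (+-identityʳ _) (zeroˡ _))) (zeroʳ _)
  dividedPower-vanishes x x₀≈0 k (n ∷ m) n+m<k =
    trans (dividedPower-total x k n m) (conv-zero k summand)
    where
    summand : ∀ a b → a ℕ.+ b ≡ k →
              dividedPower₁ (x zero) a n * dividedPower (total (x ∘ suc)) b m ≈ 0#
    summand a b ≡.refl with n ℕ.<? a
    ... | yes n<a = trans (*-congʳ (dividedPower₁-vanishes (x zero) (x₀≈0 zero) a n n<a)) (zeroˡ _)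
    ... | no  n≮a = trans (*-congˡ (dividedPower-vanishes (x ∘ suc) (x₀≈0 ∘ suc) b m
      (ℕ.+-cancelˡ-< a _ _ (ℕ.≤-<-trans (ℕ.+-monoˡ-≤ _ (ℕ.≮⇒≥ n≮a)) n+m<k)))) (zeroʳ _)

  -- The product of the exponentials of the series x i in the variables zᵢ.
  ∏exp₁ : ∀ {r} → (Fin r → ℕ → Carrier) → Series r
  ∏exp₁ x []      = 1#
  ∏exp₁ x (n ∷ m) = exp₁ (x zero) n * ∏exp₁ (x ∘ suc) m

  -- The exponential of a sum of series in distinct variables is the product of their
  -- exponentials; both truncations are harmless because the constant terms vanish.
  exp-total : ∀ {r} (x : Fin r → ℕ → Carrier) → (∀ i → x i 0 ≈ 0#) → ∀ m → exp (total x) m ≈ ∏exp₁ x m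
  exp-total x x₀≈0 []      = trans (+-identityʳ _) (trans (*-identityʳ _) inv!-0)
  exp-total x x₀≈0 (n ∷ m) = begin
    ∑ (upTo (suc (n ℕ.+ Vec.sum m))) (λ k → dividedPower (total x) k (n ∷ m))
      ≈⟨ ∑-cong (upTo (suc (n ℕ.+ Vec.sum m))) (λ k → dividedPower-total x k n m) ⟩
    ∑ (upTo (suc (n ℕ.+ Vec.sum m))) (conv (λ a b → p a * Q b))
      ≈⟨ ∑-conv (λ a b → p a * Q b) (suc n) (suc (Vec.sum m))
           (s≤s (ℕ.≤-reflexive (ℕ.+-suc n _)))
           (λ a b n<a → trans (*-congʳ (dividedPower₁-vanishes (x zero) (x₀≈0 zero) a n n<a)) (zeroˡ _))
           (λ a b m<b → trans (*-congˡ (dividedPower-vanishes (x ∘ suc) (x₀≈0 ∘ suc) b m m<b)) (zeroʳ _)) ⟩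
    ∑ (upTo (suc n)) (λ a → ∑ (upTo (suc (Vec.sum m))) (λ b → p a * Q b))
      ≈⟨ ∑-cong (upTo (suc n)) (λ a → sym (∑-*ˡ _ (upTo (suc (Vec.sum m))) Q)) ⟩
    ∑ (upTo (suc n)) (λ a → p a * exp (total (x ∘ suc)) m)
      ≈⟨ ∑-*ʳ _ (upTo (suc n)) p ⟨
    ∑ (upTo (suc n)) p * exp (total (x ∘ suc)) m
      ≈⟨ *-cong (sym (exp₁-truncate (x zero) (x₀≈0 zero) (ℕ.n<1+n n)))
                (exp-total (x ∘ suc) (x₀≈0 ∘ suc) m) ⟩
    exp₁ (x zero) n * ∏exp₁ (x ∘ suc) m
      ∎
    where
    p = λ a → dividedPower₁ (x zero) a n
    Q = λ b → dividedPower (total (x ∘ suc)) b m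

-- Relations between two coefficient rings that are compatible with their operations.
record Compatible {a₁ ℓ₁ a₂ ℓ₂ q} (R : RawSemiring a₁ ℓ₁) (R′ : RawSemiring a₂ ℓ₂)
  (_/!_ : RawSemiring.Carrier R → ℕ → RawSemiring.Carrier R)
  (_/!′_ : RawSemiring.Carrier R′ → ℕ → RawSemiring.Carrier R′)
  (_∼_ : RawSemiring.Carrier R → RawSemiring.Carrier R′ → Set q) : Set (a₁ ⊔ a₂ ⊔ q) where

  open RawSemiring R
  open RawSemiring R′ using () renaming (_+_ to _+′_; _*_ to _*′_; 0# to 0′; 1# to 1′)

  field
    ∼-0  : 0# ∼ 0′
    ∼-1  : 1# ∼ 1′
    ∼-+  : ∀ {x x′ y y′} → x ∼ x′ → y ∼ y′ → (x + y) ∼ (x′ +′ y′)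
    ∼-*  : ∀ {x x′ y y′} → x ∼ x′ → y ∼ y′ → (x * y) ∼ (x′ *′ y′)
    ∼-/! : ∀ {x x′} k → x ∼ x′ → (x /! k) ∼ (x′ /!′ k)

-- The constructions on power series preserve these relations.
module Transfer {a₁ ℓ₁ a₂ ℓ₂ q} (R : RawSemiring a₁ ℓ₁) (R′ : RawSemiring a₂ ℓ₂)
  (_/!_ : RawSemiring.Carrier R → ℕ → RawSemiring.Carrier R)
  (_/!′_ : RawSemiring.Carrier R′ → ℕ → RawSemiring.Carrier R′)
  (_∼_ : RawSemiring.Carrier R → RawSemiring.Carrier R′ → Set q)
  (compatible : Compatible R R′ _/!_ _/!′_ _∼_) where

  open Compatible compatible

  private
    module S  = PowerSeries R _/!_
    module S′ = PowerSeries R′ _/!′_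

  _≃_ : ∀ {r} → S.Series r → S′.Series r → Set q
  S ≃ T = ∀ m → S m ∼ T m

  ∑-∼ : ∀ {I : Set} (is : List I) {x x′} → (∀ i → x i ∼ x′ i) → S.∑ is x ∼ S′.∑ is x′
  ∑-∼ []       x∼x′ = ∼-0
  ∑-∼ (i ∷ is) x∼x′ = ∼-+ (x∼x′ i) (∑-∼ is x∼x′)

  constant-∼ : ∀ {r x x′} → x ∼ x′ → S.constant {r} x ≃ S′.constant x′
  constant-∼ x∼x′ []          = x∼x′
  constant-∼ x∼x′ (zero  ∷ m) = constant-∼ x∼x′ m
  constant-∼ x∼x′ (suc _ ∷ m) = ∼-0

  inVariable-∼ : ∀ {r} (i : Fin r) {x x′} → (∀ n → x n ∼ x′ n) → S.inVariable i x ≃ S′.inVariable i x′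
  inVariable-∼ zero    x∼x′ (n ∷ m)     = constant-∼ (x∼x′ n) m
  inVariable-∼ (suc i) x∼x′ (zero ∷ m)  = inVariable-∼ i x∼x′ m
  inVariable-∼ (suc i) x∼x′ (suc _ ∷ m) = ∼-0

  oddSeries-∼ : ∀ {x x′} → (∀ k → x k ∼ x′ k) → ∀ n → S.oddSeries x n ∼ S′.oddSeries x′ n
  oddSeries-∼ x∼x′ zero          = ∼-0
  oddSeries-∼ x∼x′ (suc zero)    = x∼x′ 0
  oddSeries-∼ x∼x′ (suc (suc n)) = oddSeries-∼ (x∼x′ ∘ suc) n

  power-∼ : ∀ {r} {S : S.Series r} {S′} → S ≃ S′ → ∀ k → S.power S k ≃ S′.power S′ k
  power-∼ S∼S′ zero    = constant-∼ ∼-1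
  power-∼ S∼S′ (suc k) m = ∑-∼ (splits m) (λ (i , j) → ∼-* (S∼S′ i) (power-∼ S∼S′ k j))

  exp-∼ : ∀ {r} {S : S.Series r} {S′} → S ≃ S′ → S.exp S ≃ S′.exp S′
  exp-∼ S∼S′ m = ∑-∼ (upTo (suc (Vec.sum m))) (λ k → ∼-/! k (power-∼ S∼S′ k m))

  extend-∼ : ∀ {r} {S : S.Series r} {S′} → S ≃ S′ → ∀ d → S.extend S d ∼ S′.extend S′ d
  extend-∼ S∼S′ []             = S∼S′ []
  extend-∼ S∼S′ (+ n      ∷ d) = extend-∼ (S∼S′ ∘ (n ∷_)) d
  extend-∼ S∼S′ (-[1+ _ ] ∷ d) = ∼-0

-- The coefficient of zⁿ in an odd series ∑ₖ (x k) z²ᵏ⁺¹ vanishes for all x, or it is x k for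
-- all x, where n = 2k+1.
module OddSeries {a ℓ} (R : RawSemiring a ℓ)
                 (_/!_ : RawSemiring.Carrier R → ℕ → RawSemiring.Carrier R) where

  open RawSemiring R
  open PowerSeries R _/!_

  oddSeries-coefficient : ∀ n → (∀ x → oddSeries x n ≡ 0#) ⊎
                                (∃[ k ] n ≡ odd k × (∀ x → oddSeries x n ≡ x k))
  oddSeries-coefficient zero          = inj₁ (λ _ → ≡.refl)
  oddSeries-coefficient (suc zero)    = inj₂ (0 , ≡.refl , λ _ → ≡.refl)
  oddSeries-coefficient (suc (suc n)) with oddSeries-coefficient n
  ... | inj₁ even = inj₁ (λ x → even (x ∘ suc))
  ... | inj₂ (k , n≡odd , eq) = inj₂ (suc k , ≡.trans (≡.cong (λ i → suc (suc i)) n≡odd)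
    (≡.cong (λ i → suc (suc i)) (≡.sym (ℕ.+-suc k (k ℕ.+ 0)))) , λ x → eq (x ∘ suc))

-- Boxes of multi-indices, and exponents of monomials in the ratios zⱼ/zᵢ

-- Multi-indices and triangles with all entries below N, and the lists of all of these.
Bounded : ∀ {r} → ℕ → Vec ℕ r → Set
Bounded N = All (_< N)

TriangleBounded : ∀ {r} → ℕ → Triangle r → Set
TriangleBounded {zero}  N tt        = ⊤
TriangleBounded {suc r} N (row , n) = Bounded N row × TriangleBounded N n

box : ℕ → ∀ r → List (Vec ℕ r)
box N zero    = [] ∷ []
box N (suc r) = cartesianProductWith _∷_ (upTo N) (box N r)

triangles : ℕ → ∀ r → List (Triangle r)
triangles N zero    = tt ∷ []
triangles N (suc r) = cartesianProductWith _,_ (box N r) (triangles N r)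

box-unique : ∀ N r → Unique (box N r)
box-unique N zero    = ListAll.[] AllPairs.∷ AllPairs.[]
box-unique N (suc r) =
  cartesianProductWith⁺ _∷_ (λ { ≡.refl → ≡.refl , ≡.refl }) (upTo⁺ N) (box-unique N r)

triangles-unique : ∀ N r → Unique (triangles N r)
triangles-unique N zero    = ListAll.[] AllPairs.∷ AllPairs.[]
triangles-unique N (suc r) =
  cartesianProductWith⁺ _,_ (λ { ≡.refl → ≡.refl , ≡.refl }) (box-unique N r) (triangles-unique N r)

box-complete : ∀ N {r} {m : Vec ℕ r} → Bounded N m → m ∈ box N r
box-complete N []          = here ≡.refl
box-complete N (n<N ∷ m<N) = ∈-cartesianProductWith⁺ _∷_ (∈-upTo⁺ n<N) (box-complete N m<N)

triangles-complete : ∀ N {r} {n : Triangle r} → TriangleBounded N n → n ∈ triangles N r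
triangles-complete N {zero}  _             = here ≡.refl
triangles-complete N {suc r} (row<N , n<N) =
  ∈-cartesianProductWith⁺ _,_ (box-complete N row<N) (triangles-complete N n<N)

-- The exponents of z^d z^l and z^d / z^l.
infixl 6 _⊞_ _⊟_
_⊞_ _⊟_ : ∀ {r} → Vec ℤ r → Vec ℕ r → Vec ℤ r
d ⊞ l = Vec.zipWith ℤ._+_ d (Vec.map +_ l)
d ⊟ l = Vec.zipWith ℤ._-_ d (Vec.map +_ l)

-- The exponents of z^d / ∏_{i<j} (zⱼ/zᵢ)^(n i j).
_÷_ : ∀ {r} → Vec ℤ r → Triangle r → Vec ℤ r
d ÷ n = Vec.zipWith ℤ._-_ d (exponents n)

-- The total degree of a monomial.
sumℤ : ∀ {r} → Vec ℤ r → ℤ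
sumℤ = Vec.foldr _ ℤ._+_ (+ 0)

minus-sum : ∀ {r} (d : Vec ℤ r) w (e : Vec ℤ r) →
            Vec.zipWith ℤ._-_ d (Vec.zipWith ℤ._+_ (Vec.map +_ w) e) ≡ Vec.zipWith ℤ._-_ (d ⊟ w) e
minus-sum []       []       []       = ≡.refl
minus-sum (d ∷ ds) (w ∷ ws) (e ∷ es) = ≡.cong₂ _∷_ (lemma d (+ w) e) (minus-sum ds ws es)
  where
  lemma : ∀ d w e → d ℤ.- (w ℤ.+ e) ≡ d ℤ.- w ℤ.- e
  lemma = ℤ-Solver.solve-∀

minus-plus : ∀ {r} (d w e : Vec ℤ r) →
             Vec.zipWith ℤ._+_ (Vec.zipWith ℤ._-_ d e) w ≡
             Vec.zipWith ℤ._-_ (Vec.zipWith ℤ._+_ d w) e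
minus-plus []       []       []       = ≡.refl
minus-plus (d ∷ ds) (w ∷ ws) (e ∷ es) = ≡.cong₂ _∷_ (lemma d w e) (minus-plus ds ws es)
  where
  lemma : ∀ d w e → d ℤ.- e ℤ.+ w ≡ d ℤ.+ w ℤ.- e
  lemma = ℤ-Solver.solve-∀

minus-minus : ∀ {r} (d w e : Vec ℤ r) →
              Vec.zipWith ℤ._-_ (Vec.zipWith ℤ._-_ d e) w ≡
              Vec.zipWith ℤ._-_ (Vec.zipWith ℤ._-_ d w) e
minus-minus []       []       []       = ≡.refl
minus-minus (d ∷ ds) (w ∷ ws) (e ∷ es) = ≡.cong₂ _∷_ (lemma d w e) (minus-minus ds ws es)
  where
  lemma : ∀ d w e → d ℤ.- e ℤ.- w ≡ d ℤ.- w ℤ.- e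
  lemma = ℤ-Solver.solve-∀

sumℤ-minus : ∀ {r} (d e : Vec ℤ r) → sumℤ (Vec.zipWith ℤ._-_ d e) ≡ sumℤ d ℤ.- sumℤ e
sumℤ-minus []       []       = ≡.refl
sumℤ-minus (d ∷ ds) (e ∷ es) = ≡.trans (≡.cong (λ s → d ℤ.- e ℤ.+ s) (sumℤ-minus ds es))
  (lemma d e (sumℤ ds) (sumℤ es))
  where
  lemma : ∀ d e x y → d ℤ.- e ℤ.+ (x ℤ.- y) ≡ d ℤ.+ x ℤ.- (e ℤ.+ y)
  lemma = ℤ-Solver.solve-∀

sumℤ-+ : ∀ {r} (w : Vec ℕ r) (e : Vec ℤ r) →
         sumℤ (Vec.zipWith ℤ._+_ (Vec.map +_ w) e) ≡ + Vec.sum w ℤ.+ sumℤ e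
sumℤ-+ []       []       = ≡.refl
sumℤ-+ (w ∷ ws) (e ∷ es) = ≡.trans (≡.cong (λ s → + w ℤ.+ e ℤ.+ s) (sumℤ-+ ws es))
  (lemma (+ w) e (+ Vec.sum ws) (sumℤ es))
  where
  lemma : ∀ w e x y → w ℤ.+ e ℤ.+ (x ℤ.+ y) ≡ w ℤ.+ x ℤ.+ (e ℤ.+ y)
  lemma = ℤ-Solver.solve-∀

-- The monomials in the ratios zⱼ/zᵢ are homogeneous of degree zero.
sumℤ-exponents : ∀ {r} (n : Triangle r) → sumℤ (exponents n) ≡ + 0
sumℤ-exponents {zero}  tt        = ≡.refl
sumℤ-exponents {suc r} (row , n) =
  ≡.trans (≡.cong (λ s → ℤ.- (+ Vec.sum row) ℤ.+ s) (sumℤ-+ row (exponents n)))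
  (≡.trans (≡.cong (λ s → ℤ.- (+ Vec.sum row) ℤ.+ (+ Vec.sum row ℤ.+ s)) (sumℤ-exponents n))
           (lemma (+ Vec.sum row)))
  where
  lemma : ∀ x → ℤ.- x ℤ.+ (x ℤ.+ + 0) ≡ + 0
  lemma = ℤ-Solver.solve-∀

sumℤ-≤ : ∀ {r C} {d : Vec ℤ r} → All (ℤ._≤ + C) d → sumℤ d ℤ.≤ + (r ℕ.* C)
sumℤ-≤ []          = ℤ.≤-refl
sumℤ-≤ (d≤C ∷ ds≤C) = ℤ.+-mono-≤ d≤C (sumℤ-≤ ds≤C)

sumℤ-≥0 : ∀ {r} {d : Vec ℤ r} → All (+ 0 ℤ.≤_) d → + 0 ℤ.≤ sumℤ d
sumℤ-≥0 []           = ℤ.≤-refl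
sumℤ-≥0 (0≤d ∷ 0≤ds) = ℤ.+-mono-≤ 0≤d (sumℤ-≥0 0≤ds)

⊟-≤ : ∀ {r C} {d : Vec ℤ r} w → All (ℤ._≤ + C) d → All (ℤ._≤ + C) (d ⊟ w)
⊟-≤ []      []           = []
⊟-≤ (w ∷ ws) (d≤C ∷ ds≤C) = ℤ.≤-trans (ℤ.i-j≤i _ (+ w)) d≤C ∷ ⊟-≤ ws ds≤C

⊞-≤ : ∀ {r L} (d : Vec ℤ r) {l} → Bounded L l →
      All (ℤ._≤ + (Vec.sum (Vec.map ℤ.∣_∣ d) ℕ.+ L)) (d ⊞ l)
⊞-≤ {L = L} d l<L = go d l<L ℕ.≤-refl
  where
  i≤∣i∣ : ∀ i → i ℤ.≤ + ℤ.∣ i ∣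
  i≤∣i∣ (+ n)    = ℤ.≤-refl
  i≤∣i∣ -[1+ n ] = ℤ.-≤+

  go : ∀ {r S} (d : Vec ℤ r) {l} → Bounded L l → Vec.sum (Vec.map ℤ.∣_∣ d) ≤ S →
       All (ℤ._≤ + (S ℕ.+ L)) (d ⊞ l)
  go []       []            _   = []
  go (d ∷ ds) (l<L ∷ ls<L) d≤S =
    ℤ.+-mono-≤ (ℤ.≤-trans (i≤∣i∣ d) (ℤ.+≤+ (ℕ.≤-trans (ℕ.m≤m+n _ _) d≤S))) (ℤ.+≤+ (ℕ.<⇒≤ l<L))
    ∷ go ds ls<L (ℕ.≤-trans (ℕ.m≤n+m _ ℤ.∣ d ∣) d≤S)

All-≤-sum : ∀ {r S} (w : Vec ℕ r) → Vec.sum w ≤ S → All (_≤ S) w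
All-≤-sum []       _   = []
All-≤-sum (w ∷ ws) w≤S =
  ℕ.≤-trans (ℕ.m≤m+n w _) w≤S ∷ All-≤-sum ws (ℕ.≤-trans (ℕ.m≤n+m _ w) w≤S)

-- If z^d / ∏_{i<j} (zⱼ/zᵢ)^(n i j) has no negative exponents, then d bounds n: the total
-- degree of this monomial in zᵢ₊₁,…,zᵣ is that of z^d minus ∑_{a≤i<b} n a b.
÷-bounded : ∀ {r C M} (d : Vec ℤ r) n → All (ℤ._≤ + C) d → r ℕ.* C < M →
            All (+ 0 ℤ.≤_) (d ÷ n) → TriangleBounded M n
÷-bounded {zero}  []       tt        _            _    _            = tt
÷-bounded {suc r} {C} {M} (d ∷ ds) (row , n) (_ ∷ ds≤C) rC<M (_ ∷ 0≤ds÷n) =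
  All.map (λ w≤S → ℕ.≤-<-trans (ℕ.≤-trans w≤S row≤rC) rC′<M) (All-≤-sum row ℕ.≤-refl) ,
  ÷-bounded (ds ⊟ row) n (⊟-≤ row ds≤C) rC′<M
    (≡.subst (All (+ 0 ℤ.≤_)) (minus-sum ds row (exponents n)) 0≤ds÷n)
  where
  rC′<M : r ℕ.* C < M
  rC′<M = ℕ.≤-<-trans (ℕ.m≤n+m _ C) rC<M

  e = Vec.zipWith ℤ._+_ (Vec.map +_ row) (exponents n)

  sum-e : sumℤ e ≡ + Vec.sum row
  sum-e = ≡.trans (sumℤ-+ row (exponents n))
    (≡.trans (≡.cong (λ s → + Vec.sum row ℤ.+ s) (sumℤ-exponents n)) (ℤ.+-identityʳ _))

  row≤rC : Vec.sum row ≤ r ℕ.* C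
  row≤rC = ℤ.drop‿+≤+ (ℤ.≤-trans
    (ℤ.0≤i-j⇒j≤i (≡.subst (+ 0 ℤ.≤_)
      (≡.trans (sumℤ-minus ds e) (≡.cong (λ s → sumℤ ds ℤ.- s) sum-e)) (sumℤ-≥0 0≤ds÷n)))
    (sumℤ-≤ ds≤C))

module Boxes {c ℓ} (R : CommutativeSemiring c ℓ) where

  open CommutativeSemiring R hiding (zero)
  open FiniteSums R
  open SetoidReasoning setoid

  -- The sum of a family with support in the box with side M; below, the same for triangles.
  ∑-box-extend : ∀ {M N} r {x : Vec ℕ r → Carrier} → M ≤ N → (∀ m → x m ≈ 0# ⊎ Bounded M m) →
                 ∑ (box N r) x ≈ ∑ (box M r) x
  ∑-box-extend zero M≤N x≈0 = refl
  ∑-box-extend {M} {N} (suc r) {x} M≤N x≈0 = begin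
    ∑ (box N (suc r)) x
      ≈⟨ ∑-product _∷_ (upTo N) (box N r) x ⟩
    ∑ (upTo N) (λ i → ∑ (box N r) (λ m → x (i ∷ m)))
      ≈⟨ ∑-cong (upTo N) (λ i → ∑-box-extend r {x ∘ (i ∷_)} M≤N (λ m → Sum.map₂ All.tail (x≈0 (i ∷ m)))) ⟩
    ∑ (upTo N) (λ i → ∑ (box M r) (λ m → x (i ∷ m)))
      ≈⟨ ∑-extend _ M≤N (λ i M≤i → ∑-zero (box M r) (λ m →
           [ id , (λ b → contradiction (All.head b) (ℕ.≤⇒≯ M≤i)) ]′ (x≈0 (i ∷ m)))) ⟩
    ∑ (upTo M) (λ i → ∑ (box M r) (λ m → x (i ∷ m)))
      ≈⟨ ∑-product _∷_ (upTo M) (box M r) x ⟨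
    ∑ (box M (suc r)) x
      ∎

  -- A family with support in P vanishes outside every list that contains all of P.
  ∑-∉ : ∀ {I : Set} {P : I → Set} (is : List I) {x : I → Carrier} → (∀ i → x i ≈ 0# ⊎ P i) →
        (∀ {i} → P i → i ∈ is) → ∀ i → i ∉ is → x i ≈ 0#
  ∑-∉ is x≈0 complete i i∉is = [ id , (λ Pi → contradiction (complete Pi) i∉is) ]′ (x≈0 i)

  ∑-triangles-extend : ∀ {M N} r {x : Triangle r → Carrier} → M ≤ N →
                       (∀ n → x n ≈ 0# ⊎ TriangleBounded M n) →
                       ∑ (triangles N r) x ≈ ∑ (triangles M r) x
  ∑-triangles-extend zero M≤N x≈0 = refl
  ∑-triangles-extend {M} {N} (suc r) {x} M≤N x≈0 = begin
    ∑ (triangles N (suc r)) x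
      ≈⟨ ∑-product _,_ (box N r) (triangles N r) x ⟩
    ∑ (box N r) (λ row → ∑ (triangles N r) (λ n → x (row , n)))
      ≈⟨ ∑-cong (box N r) (λ row → ∑-triangles-extend r M≤N (λ n → Sum.map₂ proj₂ (x≈0 (row , n)))) ⟩
    ∑ (box N r) (λ row → ∑ (triangles M r) (λ n → x (row , n)))
      ≈⟨ ∑-swap (box N r) (triangles M r) _ ⟩
    ∑ (triangles M r) (λ n → ∑ (box N r) (λ row → x (row , n)))
      ≈⟨ ∑-cong (triangles M r) (λ n → ∑-box-extend r M≤N (λ row → Sum.map₂ proj₁ (x≈0 (row , n)))) ⟩
    ∑ (triangles M r) (λ n → ∑ (box M r) (λ row → x (row , n)))
      ≈⟨ ∑-swap (box M r) (triangles M r) _ ⟨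
    ∑ (box M r) (λ row → ∑ (triangles M r) (λ n → x (row , n)))
      ≈⟨ ∑-product _,_ (box M r) (triangles M r) x ⟨
    ∑ (triangles M (suc r)) x
      ∎

  -- P holds for all sufficiently large N.
  Eventually : ∀ {q} → (ℕ → Set q) → Set q
  Eventually P = ∃[ M ] (∀ {N} → M ≤ N → P N)

  ∑-eventually : ∀ {I : Set} (is : List I) {x y : ℕ → I → Carrier} →
                 (∀ i → Eventually λ N → x N i ≈ y N i) → Eventually λ N → ∑ is (x N) ≈ ∑ is (y N)
  ∑-eventually []       x≈y = 0 , λ _ → refl
  ∑-eventually (i ∷ is) x≈y =
    let M , head = x≈y i ; M′ , tail = ∑-eventually is x≈y in
    M ℕ.⊔ M′ , λ M≤N → +-cong (head (ℕ.≤-trans (ℕ.m≤m⊔n M M′) M≤N)) (tail (ℕ.≤-trans (ℕ.m≤n⊔m M M′) M≤N))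

-- The polynomial ring and its differential operators

module Scalars {c ℓ₁ ℓ₂} (K : HeytingField c ℓ₁ ℓ₂) (char0 : CharacteristicZero K) where

  open Vertex K char0
  open HeytingField K using (Carrier; _≈_; _+_; _*_; -_; 0#; 1#)
  module 𝕂 = HeytingField K
  K-ring : CommutativeRing c ℓ₁
  K-ring = record { isCommutativeRing = 𝕂.isCommutativeRing }
  open CommutativeRing K-ring using (semiring; ring; commutativeSemiring)
  open RingProperties ring using (-0#≈0#)
  open SemiringMult semiring using () renaming (×1-homo-* to fromℕ-*)
  open Solver commutativeSemiring using (solve; _:=_; _:*_)
  open SetoidReasoning 𝕂.setoid

  -- The inverses in K are those of x - y for apart x and y, here with y zero.
  1/-inverse : ∀ n .{{_ : NonZero n}} → 1/ n * fromℕ n ≈ 1#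
  1/-inverse (suc n) = 𝕂.trans (𝕂.*-congˡ (𝕂.sym minus-0)) (proj₁ (proj₂ (𝕂.#⇒invertible (char0 n))))
    where
    minus-0 : fromℕ (suc n) + - 0# ≈ fromℕ (suc n)
    minus-0 = 𝕂.trans (𝕂.+-congˡ -0#≈0#) (𝕂.+-identityʳ _)

  1/!-inverse : ∀ k → 1/! k * fromℕ (k !) ≈ 1#
  1/!-inverse k = 1/-inverse (k !) {{ k ℕ.!≢0 }}

  1/!-suc : ∀ k → fromℕ (suc k) * 1/! (suc k) ≈ 1/! k
  1/!-suc k = begin
    fromℕ (suc k) * 1/! (suc k)
      ≈⟨ 𝕂.*-identityʳ _ ⟨
    fromℕ (suc k) * 1/! (suc k) * 1#
      ≈⟨ 𝕂.*-congˡ (1/!-inverse k) ⟨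
    fromℕ (suc k) * 1/! (suc k) * (1/! k * fromℕ (k !))
      ≈⟨ solve 4 (λ n u v m → n :* u :* (v :* m) := u :* (n :* m) :* v) 𝕂.refl _ _ _ _ ⟩
    1/! (suc k) * (fromℕ (suc k) * fromℕ (k !)) * 1/! k
      ≈⟨ 𝕂.*-congʳ (𝕂.*-congˡ (fromℕ-* (suc k) (k !))) ⟨
    1/! (suc k) * fromℕ (suc k !) * 1/! k
      ≈⟨ 𝕂.*-congʳ (1/!-inverse (suc k)) ⟩
    1# * 1/! k
      ≈⟨ 𝕂.*-identityˡ _ ⟩
    1/! k
      ∎

module Polynomials {c ℓ₁ ℓ₂} (K : HeytingField c ℓ₁ ℓ₂) (char0 : CharacteristicZero K) where

  open Vertex K char0
  open HeytingField K using (Carrier; _+_; _*_; 0#; 1#)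
  open Scalars K char0

  ⊗-identityʳ : ∀ f → f ⊗ con 1# ≋ f
  ⊗-identityʳ f = ≋-trans (⊗-comm f _) (⊗-identityˡ f)

  ⊕-identityʳ : ∀ f → f ⊕ con 0# ≋ f
  ⊕-identityʳ f = ≋-trans (⊕-comm f _) (⊕-identityˡ f)

  ⊗-zeroʳ : ∀ f → f ⊗ con 0# ≋ con 0#
  ⊗-zeroʳ f = ≋-trans (⊗-comm f _) (⊗-zeroˡ f)

  ⊗-distribʳ : ∀ f g h → (g ⊕ h) ⊗ f ≋ g ⊗ f ⊕ h ⊗ f
  ⊗-distribʳ f g h = ≋-trans (⊗-comm _ f)
    (≋-trans (⊗-distribˡ f g h) (⊕-cong (⊗-comm f g) (⊗-comm f h)))

  Γ-semiring : CommutativeSemiring c (c ⊔ ℓ₁)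
  Γ-semiring = record
    { Carrier = Γ
    ; _≈_ = _≋_
    ; _+_ = _⊕_
    ; _*_ = _⊗_
    ; 0# = con 0#
    ; 1# = con 1#
    ; isCommutativeSemiring = record
      { isSemiring = record
        { isSemiringWithoutAnnihilatingZero = record
          { +-isCommutativeMonoid = record
            { isMonoid = record
              { isSemigroup = record
                { isMagma = record
                  { isEquivalence = record { refl = ≋-refl ; sym = ≋-sym ; trans = ≋-trans }
                  ; ∙-cong = ⊕-cong
                  }
                ; assoc = ⊕-assoc
                }
              ; identity = ⊕-identityˡ , ⊕-identityʳ
              }
            ; comm = ⊕-comm
            }
          ; *-cong = ⊗-cong
          ; *-assoc = ⊗-assoc
          ; *-identity = ⊗-identityˡ , ⊗-identityʳ
          ; distrib = ⊗-distribˡ , ⊗-distribʳ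
          }
        ; zero = ⊗-zeroˡ , ⊗-zeroʳ
        }
      ; *-comm = ⊗-comm
      }
    }

  open FiniteSums Γ-semiring public
  open Shift Γ-semiring public
  module ΓR = CommutativeSemiring Γ-semiring
  open SetoidReasoning ΓR.setoid
  open SemiringMult ΓR.semiring using (×-congʳ)
  open Solver Γ-semiring using (solve; _:=_; _:+_; _:*_)

  ·-fromℕ : ∀ n f → n · f ≋ con (fromℕ n) ⊗ f
  ·-fromℕ zero    f = ≋-sym (⊗-zeroˡ f)
  ·-fromℕ (suc n) f = ≋-sym (begin
    con (1# + fromℕ n) ⊗ f            ≈⟨ ⊗-cong (con-+ 1# (fromℕ n)) ≋-refl ⟩
    (con 1# ⊕ con (fromℕ n)) ⊗ f      ≈⟨ ⊗-distribʳ f _ _ ⟩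
    con 1# ⊗ f ⊕ con (fromℕ n) ⊗ f    ≈⟨ ⊕-cong (⊗-identityˡ f) (≋-sym (·-fromℕ n f)) ⟩
    f ⊕ n · f                         ∎)

  ·-cancel : ∀ n {f g} → suc n · f ≋ suc n · g → f ≋ g
  ·-cancel n {f} {g} nf≋ng = ≋-trans (≋-sym (divide f)) (≋-trans (⊗-cong ≋-refl nf≋ng) (divide g))
    where
    divide : ∀ f → con (1/ suc n) ⊗ (suc n · f) ≋ f
    divide f = begin
      con (1/ suc n) ⊗ (suc n · f)                    ≈⟨ ⊗-cong ≋-refl (·-fromℕ (suc n) f) ⟩
      con (1/ suc n) ⊗ (con (fromℕ (suc n)) ⊗ f)      ≈⟨ ⊗-assoc _ _ f ⟨
      con (1/ suc n) ⊗ con (fromℕ (suc n)) ⊗ f        ≈⟨ ⊗-cong (con-* _ _) ≋-refl ⟨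
      con (1/ suc n * fromℕ (suc n)) ⊗ f              ≈⟨ ⊗-cong (con-cong (1/-inverse (suc n))) ≋-refl ⟩
      con 1# ⊗ f                                      ≈⟨ ⊗-identityˡ f ⟩
      f                                               ∎

  con-1/!-0 : con (1/! 0) ≋ con 1#
  con-1/!-0 = con-cong (𝕂.trans (𝕂.sym (𝕂.*-identityʳ _))
    (𝕂.trans (𝕂.*-congˡ (𝕂.sym (𝕂.+-identityʳ 1#))) (1/!-inverse 0)))

  con-1/!-suc : ∀ k → suc k · con (1/! (suc k)) ≋ con (1/! k)
  con-1/!-suc k = ≋-trans (·-fromℕ (suc k) _) (≋-trans (≋-sym (con-* _ _)) (con-cong (1/!-suc k)))

  Γ-inverses : FactorialInverses Γ-semiring
  Γ-inverses = record
    { cancel   = ·-cancel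
    ; inv!     = con ∘ 1/!_
    ; inv!-0   = con-1/!-0
    ; inv!-suc = con-1/!-suc
    }

  open Exponentials Γ-semiring Γ-inverses public
    using (exp₁; exp₁-def; exp₁-0; exp₁-derivative; total; ∏exp₁; exp-total)

  module ΓSeries = PowerSeries (CommutativeSemiring.rawSemiring Γ-semiring) (λ f k → con (1/! k) ⊗ f)

  ∂-cong : ∀ k {f g} → f ≋ g → ∂ k f ≋ ∂ k g
  ∂-cong k ≋-refl              = ≋-refl
  ∂-cong k (≋-sym f≋g)         = ≋-sym (∂-cong k f≋g)
  ∂-cong k (≋-trans f≋g g≋h)   = ≋-trans (∂-cong k f≋g) (∂-cong k g≋h)
  ∂-cong k (⊕-cong f≋f′ g≋g′)  = ⊕-cong (∂-cong k f≋f′) (∂-cong k g≋g′)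
  ∂-cong k (⊗-cong f≋f′ g≋g′)  =
    ⊕-cong (⊗-cong (∂-cong k f≋f′) g≋g′) (⊗-cong f≋f′ (∂-cong k g≋g′))
  ∂-cong k (con-cong x≈y)      = ≋-refl
  ∂-cong k (con-+ x y)         = ≋-sym (⊕-identityˡ _)
  ∂-cong k (con-* x y)         = ≋-sym (≋-trans (⊕-cong (⊗-zeroˡ _) (⊗-zeroʳ _)) (⊕-identityˡ _))
  ∂-cong k (⊕-assoc f g h)     = ⊕-assoc _ _ _
  ∂-cong k (⊕-comm f g)        = ⊕-comm _ _
  ∂-cong k (⊕-identityˡ f)     = ⊕-identityˡ _
  ∂-cong k (⊗-assoc f g h)     =
    solve 6 (λ f g h f′ g′ h′ → (f′ :* g :+ f :* g′) :* h :+ f :* g :* h′ :=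
                                f′ :* (g :* h) :+ f :* (g′ :* h :+ g :* h′))
      ≋-refl f g h (∂ k f) (∂ k g) (∂ k h)
  ∂-cong k (⊗-comm f g)        =
    solve 4 (λ f g f′ g′ → f′ :* g :+ f :* g′ := g′ :* f :+ g :* f′) ≋-refl f g (∂ k f) (∂ k g)
  ∂-cong k (⊗-identityˡ f)     =
    ≋-trans (⊕-cong (⊗-zeroˡ f) (⊗-identityˡ _)) (⊕-identityˡ _)
  ∂-cong k (⊗-zeroˡ f)         = ≋-trans (⊕-cong (⊗-zeroˡ f) (⊗-zeroˡ _)) (⊕-identityˡ _)
  ∂-cong k (⊗-distribˡ f g h)  =
    solve 6 (λ f g h f′ g′ h′ → f′ :* (g :+ h) :+ f :* (g′ :+ h′) :=
                                (f′ :* g :+ f :* g′) :+ (f′ :* h :+ f :* h′))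
      ≋-refl f g h (∂ k f) (∂ k g) (∂ k h)

  ∂-scalar : ∀ k x f → ∂ k (con x ⊗ f) ≋ con x ⊗ ∂ k f
  ∂-scalar k x f = ≋-trans (⊕-cong (⊗-zeroˡ f) ≋-refl) (⊕-identityˡ _)

  ∂-comm : ∀ j k f → ∂ j (∂ k f) ≋ ∂ k (∂ j f)
  ∂-comm j k (con x) = ≋-refl
  ∂-comm j k (p i)   = ≋-refl
  ∂-comm j k (f ⊕ g) = ⊕-cong (∂-comm j k f) (∂-comm j k g)
  ∂-comm j k (f ⊗ g) = begin
    (∂ j (∂ k f) ⊗ g ⊕ ∂ k f ⊗ ∂ j g) ⊕ (∂ j f ⊗ ∂ k g ⊕ f ⊗ ∂ j (∂ k g))
      ≈⟨ ⊕-cong (⊕-cong (⊗-cong (∂-comm j k f) ≋-refl) ≋-refl)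
                (⊕-cong ≋-refl (⊗-cong ≋-refl (∂-comm j k g))) ⟩
    (∂ k (∂ j f) ⊗ g ⊕ ∂ k f ⊗ ∂ j g) ⊕ (∂ j f ⊗ ∂ k g ⊕ f ⊗ ∂ k (∂ j g))
      ≈⟨ solve 4 (λ a b c d → (a :+ b) :+ (c :+ d) := (a :+ c) :+ (b :+ d)) ≋-refl _ _ _ _ ⟩
    (∂ k (∂ j f) ⊗ g ⊕ ∂ j f ⊗ ∂ k g) ⊕ (∂ k f ⊗ ∂ j g ⊕ f ⊗ ∂ k (∂ j g))
      ∎

  -- The constant-coefficient differential operator obtained from a polynomial by
  -- substituting ∂/∂p₂ₖ₊₁ for p₂ₖ₊₁.
  ρ : Γ → Op
  ρ (con x) f = con x ⊗ f
  ρ (p k)   f = ∂ k f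
  ρ (u ⊕ v) f = ρ u f ⊕ ρ v f
  ρ (u ⊗ v) f = ρ u (ρ v f)

  ρ-congʳ : ∀ u {f g} → f ≋ g → ρ u f ≋ ρ u g
  ρ-congʳ (con x) f≋g = ⊗-cong ≋-refl f≋g
  ρ-congʳ (p k)   f≋g = ∂-cong k f≋g
  ρ-congʳ (u ⊕ v) f≋g = ⊕-cong (ρ-congʳ u f≋g) (ρ-congʳ v f≋g)
  ρ-congʳ (u ⊗ v) f≋g = ρ-congʳ u (ρ-congʳ v f≋g)

  ρ-⊕ : ∀ u f g → ρ u (f ⊕ g) ≋ ρ u f ⊕ ρ u g
  ρ-⊕ (con x) f g = ⊗-distribˡ _ f g
  ρ-⊕ (p k)   f g = ≋-refl
  ρ-⊕ (u ⊕ v) f g = ≋-trans (⊕-cong (ρ-⊕ u f g) (ρ-⊕ v f g))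
    (solve 4 (λ a b c d → (a :+ b) :+ (c :+ d) := (a :+ c) :+ (b :+ d)) ≋-refl _ _ _ _)
  ρ-⊕ (u ⊗ v) f g = ≋-trans (ρ-congʳ u (ρ-⊕ v f g)) (ρ-⊕ u _ _)

  ρ-scalar : ∀ u x f → ρ u (con x ⊗ f) ≋ con x ⊗ ρ u f
  ρ-scalar (con y) x f = solve 3 (λ x y f → y :* (x :* f) := x :* (y :* f)) ≋-refl (con x) (con y) f
  ρ-scalar (p k)   x f = ∂-scalar k x f
  ρ-scalar (u ⊕ v) x f = ≋-trans (⊕-cong (ρ-scalar u x f) (ρ-scalar v x f)) (≋-sym (⊗-distribˡ _ _ _))
  ρ-scalar (u ⊗ v) x f = ≋-trans (ρ-congʳ u (ρ-scalar v x f)) (ρ-scalar u x _)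

  ρ-0 : ∀ u → ρ u (con 0#) ≋ con 0#
  ρ-0 u = ≋-trans (ρ-congʳ u (≋-sym (⊗-zeroˡ (con 0#)))) (≋-trans (ρ-scalar u 0# _) (⊗-zeroˡ _))

  ρ-additive : ∀ u → Additive (ρ u)
  ρ-additive u = record { homo-0 = ρ-0 u ; homo-+ = ρ-⊕ u }

  ρ-∂-comm : ∀ u k f → ρ u (∂ k f) ≋ ∂ k (ρ u f)
  ρ-∂-comm (con x) k f = ≋-sym (∂-scalar k x f)
  ρ-∂-comm (p j)   k f = ∂-comm j k f
  ρ-∂-comm (u ⊕ v) k f = ⊕-cong (ρ-∂-comm u k f) (ρ-∂-comm v k f)
  ρ-∂-comm (u ⊗ v) k f = ≋-trans (ρ-congʳ u (ρ-∂-comm v k f)) (ρ-∂-comm u k _)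

  ρ-comm : ∀ u v f → ρ u (ρ v f) ≋ ρ v (ρ u f)
  ρ-comm u (con x) f = ρ-scalar u x f
  ρ-comm u (p k)   f = ρ-∂-comm u k f
  ρ-comm u (v ⊕ w) f = ≋-trans (ρ-⊕ u _ _) (⊕-cong (ρ-comm u v f) (ρ-comm u w f))
  ρ-comm u (v ⊗ w) f = ≋-trans (ρ-comm u v _) (ρ-congʳ v (ρ-comm u w f))

  ρ-congˡ : ∀ {u v} → u ≋ v → ∀ f → ρ u f ≋ ρ v f
  ρ-congˡ ≋-refl                   f = ≋-refl
  ρ-congˡ (≋-sym u≋v)              f = ≋-sym (ρ-congˡ u≋v f)
  ρ-congˡ (≋-trans u≋v v≋w)        f = ≋-trans (ρ-congˡ u≋v f) (ρ-congˡ v≋w f)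
  ρ-congˡ (⊕-cong u≋u′ v≋v′)       f = ⊕-cong (ρ-congˡ u≋u′ f) (ρ-congˡ v≋v′ f)
  ρ-congˡ (⊗-cong {u} u≋u′ v≋v′)   f = ≋-trans (ρ-congʳ u (ρ-congˡ v≋v′ f)) (ρ-congˡ u≋u′ _)
  ρ-congˡ (con-cong x≈y)           f = ⊗-cong (con-cong x≈y) ≋-refl
  ρ-congˡ (con-+ x y)              f = ≋-trans (⊗-cong (con-+ x y) ≋-refl) (⊗-distribʳ f _ _)
  ρ-congˡ (con-* x y)              f = ≋-trans (⊗-cong (con-* x y) ≋-refl) (⊗-assoc _ _ f)
  ρ-congˡ (⊕-assoc u v w)          f = ⊕-assoc _ _ _
  ρ-congˡ (⊕-comm u v)             f = ⊕-comm _ _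
  ρ-congˡ (⊕-identityˡ u)          f = ≋-trans (⊕-cong (⊗-zeroˡ f) ≋-refl) (⊕-identityˡ _)
  ρ-congˡ (⊗-assoc u v w)          f = ≋-refl
  ρ-congˡ (⊗-comm u v)             f = ρ-comm u v f
  ρ-congˡ (⊗-identityˡ u)          f = ⊗-identityˡ _
  ρ-congˡ (⊗-zeroˡ u)              f = ≋-trans (⊗-zeroˡ _) (≋-sym (⊗-zeroˡ f))
  ρ-congˡ (⊗-distribˡ u v w)       f = ρ-⊕ u _ _

  ρ-additiveˡ : ∀ f → Additive (λ u → ρ u f)
  ρ-additiveˡ f = record { homo-0 = ⊗-zeroˡ f ; homo-+ = λ u v → ≋-refl }

  -- In a convolution with weight a the summand with a = 0 is zero, so that only indices
  -- i < j matter; this is what makes inductions on j work.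
  conv-weighted-cong : ∀ {X Y : ℕ → ℕ → Γ} j →
    (∀ a i → suc a ℕ.+ i ≡ j → X (suc a) i ≋ Y (suc a) i) →
    conv (λ a i → a · X a i) j ≋ conv (λ a i → a · Y a i) j
  conv-weighted-cong {X} {Y} j X≋Y = conv-cong j summand
    where
    summand : ∀ a i → a ℕ.+ i ≡ j → a · X a i ≋ a · Y a i
    summand zero    i _   = ≋-refl
    summand (suc a) i a+i = ×-congʳ (suc a) (X≋Y a i a+i)

  -- The degree of an expression, where p k has degree 2k+1: an upper bound for the degree
  -- of the polynomial.
  degree : Γ → ℕ
  degree (con x) = 0
  degree (p k)   = odd k
  degree (f ⊕ g) = degree f ℕ.⊔ degree g
  degree (f ⊗ g) = degree f ℕ.+ degree g

  -- The coefficient of zʲ in exp (∑ₐ ρ (b a) zᵃ).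
  expρ : (ℕ → Γ) → ℕ → Op
  expρ b j = ρ (exp₁ b j)

  -- The embedding of K into Γ commutes with the constructions on power series.
  con-compatible : Compatible (rawSemiring K) (CommutativeSemiring.rawSemiring Γ-semiring)
    (λ x k → 1/! k * x) (λ f k → con (1/! k) ⊗ f) (λ x f → con x ≋ f)
  con-compatible = record
    { ∼-0  = ≋-refl
    ; ∼-1  = ≋-refl
    ; ∼-+  = λ x y → ≋-trans (con-+ _ _) (⊕-cong x y)
    ; ∼-*  = λ x y → ≋-trans (con-* _ _) (⊗-cong x y)
    ; ∼-/! = λ k x → ≋-trans (con-* _ _) (⊗-cong ≋-refl x)
    }

  module Scalar = Transfer _ _ _ _ _ con-compatible

  -- The operators ρ (b a) are derivations that kill the scalars and map every generator to a
  -- scalar, which is zero when a exceeds the degree of the generator; and b 0 is zero. Then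
  -- exp (∑ₐ ρ (b a) zᵃ) is a translation of the generators by polynomials in z.
  record IsTranslation (b : ℕ → Γ) : Set (c ⊔ ℓ₁) where
    field
      b₀            : b 0 ≋ con 0#
      derivation    : ∀ a f g → ρ (b a) (f ⊗ g) ≋ ρ (b a) f ⊗ g ⊕ f ⊗ ρ (b a) g
      scalar        : ∀ a x → ρ (b a) (con x) ≋ con 0#
      generator     : ∀ a k → ∃[ x ] ρ (b a) (p k) ≋ con x
      generator-top : ∀ a k → odd k < a → ρ (b a) (p k) ≋ con 0#

-- Exponentials of derivations

module Translation {c ℓ₁ ℓ₂} (K : HeytingField c ℓ₁ ℓ₂) (char0 : CharacteristicZero K)
  (b : ℕ → Vertex.Γ K char0) (isTranslation : Polynomials.IsTranslation K char0 b) where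

  open Vertex K char0
  open HeytingField K using (Carrier; _≈_; 0#)
  open Polynomials K char0
  open IsTranslation isTranslation
  open SetoidReasoning ΓR.setoid
  open SemiringMult ΓR.semiring using (×-congʳ; ×-comm-*; ×-assoc-*)
  open Solver Γ-semiring using (solve; _:=_; _:*_)

  private
    D : ℕ → Op
    D = expρ b

  D-0 : ∀ f → D 0 f ≋ f
  D-0 f = ≋-trans (ρ-congˡ (exp₁-0 b b₀) f) (⊗-identityˡ f)

  -- The differential equation of the exponential, applied to f.
  D-derivative : ∀ j f → j · D j f ≋ conv (λ a i → a · D i (ρ (b a) f)) j
  D-derivative j f = begin
    j · ρ (exp₁ b j) f
      ≈⟨ additive-· (ρ-additiveˡ f) j _ ⟨
    ρ (j · exp₁ b j) f
      ≈⟨ ρ-congˡ (exp₁-derivative b b₀ j) f ⟩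
    ρ (conv (λ a i → (a · b a) ⊗ exp₁ b i) j) f
      ≈⟨ conv-additive (ρ-additiveˡ f) _ j ⟩
    conv (λ a i → ρ (a · b a) (D i f)) j
      ≈⟨ conv-cong′ j (λ a i → additive-· (ρ-additiveˡ (D i f)) a (b a)) ⟩
    conv (λ a i → a · ρ (b a) (D i f)) j
      ≈⟨ conv-cong′ j (λ a i → ×-congʳ a (ρ-comm (b a) (exp₁ b i) f)) ⟩
    conv (λ a i → a · D i (ρ (b a) f)) j
      ∎

  -- The exponential of a derivation is multiplicative.
  D-⊗ : ∀ j f g → D j (f ⊗ g) ≋ conv (λ i k → D i f ⊗ D k g) j
  D-⊗ = <-rec _ step
    where
    -- The two terms of the product rule for ρ (b a), after reassociation.
    left : ∀ j f g → conv (λ a i → a · conv (λ i k → D i (ρ (b a) f) ⊗ D k g) i) j ≋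
                     conv (λ i k → i · (D i f ⊗ D k g)) j
    left j f g = begin
      conv (λ a i → a · conv (λ i k → D i (ρ (b a) f) ⊗ D k g) i) j
        ≈⟨ conv-cong′ j (λ a i → ≋-trans (conv-additive (·-additive a) _ i)
             (conv-cong′ i (λ i k → ≋-sym (×-assoc-* a _ _)))) ⟩
      conv (λ a l → conv (λ i k → (a · D i (ρ (b a) f)) ⊗ D k g) l) j
        ≈⟨ conv-assoc (λ a i k → (a · D i (ρ (b a) f)) ⊗ D k g) j ⟩
      conv (λ h k → conv (λ a i → (a · D i (ρ (b a) f)) ⊗ D k g) h) j
        ≈⟨ conv-cong′ j (λ h k → ≋-sym (conv-*ʳ (D k g) _ h)) ⟩
      conv (λ h k → conv (λ a i → a · D i (ρ (b a) f)) h ⊗ D k g) j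
        ≈⟨ conv-cong′ j (λ h k → ⊗-cong (≋-sym (D-derivative h f)) ≋-refl) ⟩
      conv (λ h k → (h · D h f) ⊗ D k g) j
        ≈⟨ conv-cong′ j (λ h k → ×-assoc-* h _ _) ⟩
      conv (λ h k → h · (D h f ⊗ D k g)) j
        ∎

    right : ∀ j f g → conv (λ a i → a · conv (λ i k → D i f ⊗ D k (ρ (b a) g)) i) j ≋
                      conv (λ i k → k · (D i f ⊗ D k g)) j
    right j f g = begin
      conv (λ a i → a · conv (λ i k → D i f ⊗ D k (ρ (b a) g)) i) j
        ≈⟨ conv-cong′ j (λ a i → ≋-trans (conv-additive (·-additive a) _ i)
             (conv-cong′ i (λ i k → ≋-sym (×-comm-* a _ _)))) ⟩
      conv (λ a l → conv (λ i k → D i f ⊗ (a · D k (ρ (b a) g))) l) j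
        ≈⟨ conv-swap (λ a i k → D i f ⊗ (a · D k (ρ (b a) g))) j ⟩
      conv (λ i l → conv (λ a k → D i f ⊗ (a · D k (ρ (b a) g))) l) j
        ≈⟨ conv-cong′ j (λ i l → ≋-sym (conv-*ˡ (D i f) _ l)) ⟩
      conv (λ i l → D i f ⊗ conv (λ a k → a · D k (ρ (b a) g)) l) j
        ≈⟨ conv-cong′ j (λ i l → ⊗-cong ≋-refl (≋-sym (D-derivative l g))) ⟩
      conv (λ i l → D i f ⊗ (l · D l g)) j
        ≈⟨ conv-cong′ j (λ i l → ×-comm-* l _ _) ⟩
      conv (λ i l → l · (D i f ⊗ D l g)) j
        ∎

    step : ∀ j → (∀ {i} → i < j → ∀ f g → D i (f ⊗ g) ≋ conv (λ i k → D i f ⊗ D k g) i) →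
           ∀ f g → D j (f ⊗ g) ≋ conv (λ i k → D i f ⊗ D k g) j
    step zero    rec f g = ≋-trans (D-0 _)
      (≋-sym (≋-trans (conv-at-0 _) (⊗-cong (D-0 f) (D-0 g))))
    step (suc n) rec f g = let j = suc n in ·-cancel n (begin
      j · D j (f ⊗ g)
        ≈⟨ D-derivative j (f ⊗ g) ⟩
      conv (λ a i → a · D i (ρ (b a) (f ⊗ g))) j
        ≈⟨ conv-weighted-cong j (λ a i a+i → expand (suc a) i (below a i a+i)) ⟩
      conv (λ a i → a · (conv (λ i k → D i (ρ (b a) f) ⊗ D k g) i ⊕
                         conv (λ i k → D i f ⊗ D k (ρ (b a) g)) i)) j
        ≈⟨ conv-cong′ j (λ a i → Additive.homo-+ (·-additive a) _ _) ⟩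
      conv (λ a i → a · conv (λ i k → D i (ρ (b a) f) ⊗ D k g) i ⊕
                    a · conv (λ i k → D i f ⊗ D k (ρ (b a) g)) i) j
        ≈⟨ conv-+ _ _ j ⟩
      conv (λ a i → a · conv (λ i k → D i (ρ (b a) f) ⊗ D k g) i) j ⊕
      conv (λ a i → a · conv (λ i k → D i f ⊗ D k (ρ (b a) g)) i) j
        ≈⟨ ⊕-cong (left j f g) (right j f g) ⟩
      conv (λ i k → i · (D i f ⊗ D k g)) j ⊕ conv (λ i k → k · (D i f ⊗ D k g)) j
        ≈⟨ conv-Leibniz (λ i k → D i f ⊗ D k g) j ⟨
      j · conv (λ i k → D i f ⊗ D k g) j
        ∎)
      where
      below : ∀ a i → suc a ℕ.+ i ≡ suc n → i < suc n
      below a i ≡.refl = s≤s (ℕ.m≤n+m i a)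

      expand : ∀ a i → i < suc n → D i (ρ (b a) (f ⊗ g)) ≋
        conv (λ i k → D i (ρ (b a) f) ⊗ D k g) i ⊕ conv (λ i k → D i f ⊗ D k (ρ (b a) g)) i
      expand a i i<j = begin
        D i (ρ (b a) (f ⊗ g))                          ≈⟨ ρ-congʳ (exp₁ b i) (derivation a f g) ⟩
        D i (ρ (b a) f ⊗ g ⊕ f ⊗ ρ (b a) g)            ≈⟨ ρ-⊕ (exp₁ b i) _ _ ⟩
        D i (ρ (b a) f ⊗ g) ⊕ D i (f ⊗ ρ (b a) g)      ≈⟨ ⊕-cong (rec i<j _ g) (rec i<j f _) ⟩
        conv (λ i k → D i (ρ (b a) f) ⊗ D k g) i ⊕ conv (λ i k → D i f ⊗ D k (ρ (b a) g)) i  ∎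

  D-suc-zero : ∀ j f → (∀ a i → suc a ℕ.+ i ≡ suc j → D i (ρ (b (suc a)) f) ≋ con 0#) →
               D (suc j) f ≋ con 0#
  D-suc-zero j f δ≋0 = ·-cancel j (begin
    suc j · D (suc j) f                                  ≈⟨ D-derivative (suc j) f ⟩
    conv (λ a i → a · D i (ρ (b a) f)) (suc j)           ≈⟨ conv-weighted-cong (suc j) δ≋0 ⟩
    conv (λ a i → a · con 0#) (suc j)                    ≈⟨ conv-zero (suc j) (λ a i _ → ·-zero a) ⟩
    con 0#                                               ≈⟨ ·-zero (suc j) ⟨
    suc j · con 0#                                       ∎)

  D-scalar : ∀ j x → D (suc j) (con x) ≋ con 0#
  D-scalar j x = D-suc-zero j (con x)
    (λ a i _ → ≋-trans (ρ-congʳ (exp₁ b i) (scalar (suc a) x)) (ρ-0 (exp₁ b i)))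

  D-degree : ∀ f j → degree f < j → D j f ≋ con 0#
  D-degree (con x) (suc j) _     = D-scalar j x
  D-degree (p k)   (suc j) k≤j   = D-suc-zero j (p k) summand
    where
    summand : ∀ a i → suc a ℕ.+ i ≡ suc j → D i (ρ (b (suc a)) (p k)) ≋ con 0#
    summand a (suc i) _   = let x , δp≋x = generator (suc a) k in
      ≋-trans (ρ-congʳ (exp₁ b (suc i)) δp≋x) (D-scalar i x)
    summand a zero    a≡j = ≋-trans (D-0 _) (generator-top (suc a) k
      (≡.subst (odd k <_) (≡.trans (≡.sym a≡j) (ℕ.+-identityʳ (suc a))) k≤j))
  D-degree (f ⊕ g) j d<j = ≋-trans (ρ-⊕ (exp₁ b j) f g) (≋-trans
    (⊕-cong (D-degree f j (ℕ.≤-<-trans (ℕ.m≤m⊔n _ _) d<j))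
            (D-degree g j (ℕ.≤-<-trans (ℕ.m≤n⊔m (degree f) _) d<j)))
    (⊕-identityˡ _))
  D-degree (f ⊗ g) j d<j = ≋-trans (D-⊗ j f g) (conv-zero j summand)
    where
    summand : ∀ i k → i ℕ.+ k ≡ j → D i f ⊗ D k g ≋ con 0#
    summand i k ≡.refl =
      [ (λ f<i → ≋-trans (⊗-cong (D-degree f i f<i) ≋-refl) (⊗-zeroˡ _))
      , (λ i≤f → ≋-trans (⊗-cong ≋-refl (D-degree g k
          (ℕ.+-cancelˡ-< i _ _ (ℕ.≤-<-trans (ℕ.+-monoˡ-≤ _ i≤f) d<j)))) (⊗-zeroʳ _))
      ]′ (ℕ.<-≤-connex (degree f) i)

  -- The action on the exponential of a series x(y) = ∑ᵢ (x i) yⁱ when every ρ (b a) maps x(y)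
  -- to the monomial (w a) yᵃ.
  module _ (x : ℕ → Γ) (x₀ : x 0 ≋ con 0#) (w : ℕ → Carrier) (w₀ : w 0 ≈ 0#)
    (contraction : ∀ a → ρ (b a) (x a) ≋ con (w a))
    (orthogonal  : ∀ a i → a ≢ i → ρ (b a) (x i) ≋ con 0#) where

    -- A derivation maps exp x(y) to the product of its value at x(y) with exp x(y).
    derivation-exp : ∀ a n → ρ (b a) (exp₁ x n) ≋ con (w a) ⊗ shift a (exp₁ x) n
    derivation-exp a = <-rec _ step
      where
      E = exp₁ x
      step : ∀ n → (∀ {i} → i < n → ρ (b a) (E i) ≋ con (w a) ⊗ shift a E i) →
             ρ (b a) (E n) ≋ con (w a) ⊗ shift a E n
      step zero    rec = ≋-trans (ρ-congʳ (b a) (exp₁-0 x x₀))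
        (≋-trans (scalar a _) (≋-sym (constantTerm a)))
        where
        constantTerm : ∀ a → con (w a) ⊗ shift a E 0 ≋ con 0#
        constantTerm zero    = ≋-trans (⊗-cong (con-cong w₀) ≋-refl) (⊗-zeroˡ _)
        constantTerm (suc a) = ⊗-zeroʳ _
      step (suc m) rec = let n = suc m in ·-cancel m (begin
        n · ρ (b a) (E n)
          ≈⟨ additive-· (ρ-additive (b a)) n _ ⟨
        ρ (b a) (n · E n)
          ≈⟨ ρ-congʳ (b a) (exp₁-derivative x x₀ n) ⟩
        ρ (b a) (conv (λ i j → (i · x i) ⊗ E j) n)
          ≈⟨ conv-additive (ρ-additive (b a)) _ n ⟩
        conv (λ i j → ρ (b a) ((i · x i) ⊗ E j)) n
          ≈⟨ conv-cong′ n (λ i j → derivation a _ _) ⟩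
        conv (λ i j → ρ (b a) (i · x i) ⊗ E j ⊕ (i · x i) ⊗ ρ (b a) (E j)) n
          ≈⟨ conv-+ _ _ n ⟩
        conv (λ i j → ρ (b a) (i · x i) ⊗ E j) n ⊕ conv (λ i j → (i · x i) ⊗ ρ (b a) (E j)) n
          ≈⟨ ⊕-cong first second ⟩
        con (w a) ⊗ (a · shift a E n) ⊕ con (w a) ⊗ shift a (λ k → k · E k) n
          ≈⟨ ⊗-distribˡ _ _ _ ⟨
        con (w a) ⊗ (a · shift a E n ⊕ shift a (λ k → k · E k) n)
          ≈⟨ ⊗-cong ≋-refl (shift-Leibniz a E n) ⟨
        con (w a) ⊗ (n · shift a E n)
          ≈⟨ ×-comm-* n _ _ ⟩
        n · (con (w a) ⊗ shift a E n)
          ∎)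
        where
        first : conv (λ i j → ρ (b a) (i · x i) ⊗ E j) (suc m) ≋ con (w a) ⊗ (a · shift a E (suc m))
        first = begin
          conv (λ i j → ρ (b a) (i · x i) ⊗ E j) (suc m)
            ≈⟨ conv-cong′ (suc m) (λ i j → ⊗-cong (additive-· (ρ-additive (b a)) i (x i)) ≋-refl) ⟩
          conv (λ i j → (i · ρ (b a) (x i)) ⊗ E j) (suc m)
            ≈⟨ conv-single a E (suc m)
                 (λ i a≢i → ≋-trans (×-congʳ i (orthogonal a i a≢i)) (·-zero i)) ⟩
          (a · ρ (b a) (x a)) ⊗ shift a E (suc m)
            ≈⟨ ×-assoc-* a _ _ ⟩
          a · (ρ (b a) (x a) ⊗ shift a E (suc m))
            ≈⟨ ×-comm-* a _ _ ⟨
          ρ (b a) (x a) ⊗ (a · shift a E (suc m))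
            ≈⟨ ⊗-cong (contraction a) ≋-refl ⟩
          con (w a) ⊗ (a · shift a E (suc m))
            ∎

        inner : ∀ i j → i ℕ.+ j ≡ suc m → (i · x i) ⊗ ρ (b a) (E j) ≋
                                          con (w a) ⊗ ((i · x i) ⊗ shift a E j)
        inner zero    j _      = ≋-trans (⊗-zeroˡ _)
          (≋-sym (≋-trans (⊗-cong ≋-refl (⊗-zeroˡ _)) (⊗-zeroʳ _)))
        inner (suc i) j ≡.refl = ≋-trans (⊗-cong ≋-refl (rec (s≤s (ℕ.m≤n+m j i))))
          (solve 3 (λ y w s → y :* (w :* s) := w :* (y :* s)) ≋-refl _ _ _)

        second : conv (λ i j → (i · x i) ⊗ ρ (b a) (E j)) (suc m) ≋
                 con (w a) ⊗ shift a (λ k → k · E k) (suc m)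
        second = begin
          conv (λ i j → (i · x i) ⊗ ρ (b a) (E j)) (suc m)
            ≈⟨ conv-cong (suc m) inner ⟩
          conv (λ i j → con (w a) ⊗ ((i · x i) ⊗ shift a E j)) (suc m)
            ≈⟨ conv-*ˡ _ _ (suc m) ⟨
          con (w a) ⊗ conv (λ i j → (i · x i) ⊗ shift a E j) (suc m)
            ≈⟨ ⊗-cong ≋-refl (conv-shift a (λ i → i · x i) E (suc m)) ⟩
          con (w a) ⊗ shift a (conv (λ i j → (i · x i) ⊗ E j)) (suc m)
            ≈⟨ ⊗-cong ≋-refl (shift-cong a (suc m) (λ k → ≋-sym (exp₁-derivative x x₀ k))) ⟩
          con (w a) ⊗ shift a (λ k → k · E k) (suc m)
            ∎

    -- The translation multiplies exp x(y) by the exponential of ∑ₐ (w a) (yz)ᵃ.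
    D-exp : ∀ j n → D j (exp₁ x n) ≋ exp₁ (con ∘ w) j ⊗ shift j (exp₁ x) n
    D-exp = <-rec _ step
      where
      E = exp₁ x
      Φ = exp₁ (con ∘ w)
      step : ∀ j → (∀ {i} → i < j → ∀ n → D i (E n) ≋ Φ i ⊗ shift i E n) →
             ∀ n → D j (E n) ≋ Φ j ⊗ shift j E n
      step zero    rec n = ≋-trans (D-0 _)
        (≋-sym (≋-trans (⊗-cong (exp₁-0 (con ∘ w) (con-cong w₀)) ≋-refl) (⊗-identityˡ _)))
      step (suc m) rec n = let j = suc m in ·-cancel m (begin
        j · D j (E n)
          ≈⟨ D-derivative j (E n) ⟩
        conv (λ a i → a · D i (ρ (b a) (E n))) j
          ≈⟨ conv-weighted-cong j summand ⟩
        conv (λ a i → a · (con (w a) ⊗ Φ i ⊗ shift j E n)) j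
          ≈⟨ conv-cong′ j (λ a i → ≋-trans (≋-sym (×-assoc-* a _ _))
               (⊗-cong (≋-sym (×-assoc-* a _ _)) ≋-refl)) ⟩
        conv (λ a i → (a · con (w a)) ⊗ Φ i ⊗ shift j E n) j
          ≈⟨ conv-*ʳ _ _ j ⟨
        conv (λ a i → (a · con (w a)) ⊗ Φ i) j ⊗ shift j E n
          ≈⟨ ⊗-cong (exp₁-derivative (con ∘ w) (con-cong w₀) j) ≋-refl ⟨
        (j · Φ j) ⊗ shift j E n
          ≈⟨ ×-assoc-* j _ _ ⟩
        j · (Φ j ⊗ shift j E n)
          ∎)
        where
        shifted : ∀ a i n → i < suc m → D i (shift a E n) ≋ Φ i ⊗ shift (a ℕ.+ i) E n
        shifted zero    i n       i<j = rec i<j n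
        shifted (suc a) i zero    i<j = ≋-trans (ρ-0 (exp₁ b i)) (≋-sym (⊗-zeroʳ _))
        shifted (suc a) i (suc n) i<j = shifted a i n i<j

        summand : ∀ a i → suc a ℕ.+ i ≡ suc m →
                  D i (ρ (b (suc a)) (E n)) ≋ con (w (suc a)) ⊗ Φ i ⊗ shift (suc m) E n
        summand a i ≡.refl = begin
          D i (ρ (b (suc a)) (E n))
            ≈⟨ ρ-congʳ (exp₁ b i) (derivation-exp (suc a) n) ⟩
          D i (con (w (suc a)) ⊗ shift (suc a) E n)
            ≈⟨ ρ-scalar (exp₁ b i) _ _ ⟩
          con (w (suc a)) ⊗ D i (shift (suc a) E n)
            ≈⟨ ⊗-cong ≋-refl (shifted (suc a) i n (s≤s (ℕ.m≤n+m i a))) ⟩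
          con (w (suc a)) ⊗ (Φ i ⊗ shift (suc a ℕ.+ i) E n)
            ≈⟨ ⊗-assoc _ _ _ ⟨
          con (w (suc a)) ⊗ Φ i ⊗ shift (suc a ℕ.+ i) E n
            ∎

-- The coefficients of the vertex operators

module VertexOperators {c ℓ₁ ℓ₂} (K : HeytingField c ℓ₁ ℓ₂) (char0 : CharacteristicZero K) where

  open Vertex K char0 public
  open HeytingField K public using (Carrier; _≈_; _*_; -_; 0#; 1#)
  open Scalars K char0 public
  open Polynomials K char0 public
  open OddSeries (CommutativeSemiring.rawSemiring Γ-semiring) (λ f k → con (1/! k) ⊗ f)
  open Parameter using (1-^; 1/1-^)
  open SetoidReasoning ΓR.setoid
  open Solver Γ-semiring using (solve; _:=_; _:+_; _:*_)

  ∂-same : ∀ k → ∂ k (p k) ≋ con 1#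
  ∂-same k = ΓR.reflexive
    (≡.cong (λ b → con (if b then 1# else 0#)) (dec-true (k ℕ.≟ k) ≡.refl))

  ∂-other : ∀ {k j} → k ≢ j → ∂ k (p j) ≋ con 0#
  ∂-other {k} {j} k≢j = ΓR.reflexive
    (≡.cong (λ b → con (if b then 1# else 0#)) (dec-false (k ℕ.≟ j) k≢j))

  -- The scalars in A t = ∑ α a₋ₙ zⁿ, B t = ∑ β aₙ z⁻ⁿ, aₙ = γ ∂/∂pₙ and in the logarithm of
  -- F_{t,s}, for n = 2k+1.
  α β : Parameter → ℕ → Carrier
  α t k = fromℕ 2 * 1-^ t k * 1/ odd k
  β t k = - (fromℕ 2 * 1/ odd k * 1/1-^ t k)

  γ : ℕ → Carrier
  γ k = fromℕ (odd k) * 1/ 2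

  logF : Parameter → Parameter → ℕ → Carrier
  logF t s k = - (fromℕ 2 * (1-^ s k * 1/1-^ t k * 1/ odd k))

  β*γ*α : ∀ t s k → β t k * (γ k * α s k) ≈ logF t s k
  β*γ*α t s k = 𝕂.trans (𝕂.sym (-‿distribˡ-* _ _)) (𝕂.-‿cong (𝕂.trans
    (solveK 6 (λ two n⁻¹ t⁻¹ n half s →
        (two :×: n⁻¹ :×: t⁻¹) :×: ((n :×: half) :×: (two :×: s :×: n⁻¹)) ∶=
        (two :×: (s :×: t⁻¹ :×: n⁻¹)) :×: ((n⁻¹ :×: n) :×: (half :×: two)))
      𝕂.refl (fromℕ 2) (1/ odd k) (1/1-^ t k) (fromℕ (odd k)) (1/ 2) (1-^ s k))
    (𝕂.trans (𝕂.*-congˡ (𝕂.trans (𝕂.*-cong (1/-inverse (odd k)) (1/-inverse 2)) (𝕂.*-identityˡ 1#)))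
             (𝕂.*-identityʳ _))))
    where
    open RingProperties (CommutativeRing.ring K-ring) using (-‿distribˡ-*)
    open Solver (CommutativeRing.commutativeSemiring K-ring)
      using () renaming (solve to solveK; _:*_ to _:×:_; _:=_ to _∶=_)

  -- The elements of Γ whose multiplication operators are the coefficients of A t, and those
  -- whose differential operators are the coefficients of B t.
  a-coeff b-coeff : Parameter → ℕ → Γ
  a-coeff t = ΓSeries.oddSeries λ k → con (α t k) ⊗ p k
  b-coeff t = ΓSeries.oddSeries λ k → con (β t k) ⊗ (con (γ k) ⊗ p k)

  logF-coeff : Parameter → Parameter → ℕ → Carrier
  logF-coeff t s = KSeries.oddSeries (logF t s)

  -- Every coefficient of b-coeff t is zero or one of the given terms, at an odd index.
  module _ {q} (t : Parameter) (P : ℕ → Γ → Set q) (P-0 : ∀ a → P a (con 0#))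
    (P-odd : ∀ k → P (odd k) (con (β t k) ⊗ (con (γ k) ⊗ p k))) where

    b-coeff-elim : ∀ a → P a (b-coeff t a)
    b-coeff-elim a =
      [ (λ even → ≡.subst (P a) (≡.sym (even _)) (P-0 a))
      , (λ (k , a≡odd , eq) → ≡.subst₂ P (≡.sym a≡odd) (≡.sym (eq _)) (P-odd k))
      ]′ (oddSeries-coefficient a)

  -- The coefficient of z⁻ʲ in e^{B_t(z)}.
  D : Parameter → ℕ → Op
  D t = expρ (b-coeff t)

  module _ (t : Parameter) where

    private
      b = b-coeff t

    b-derivation : ∀ a f g → ρ (b a) (f ⊗ g) ≋ ρ (b a) f ⊗ g ⊕ f ⊗ ρ (b a) g
    b-derivation = b-coeff-elim t (λ a u → ∀ f g → ρ u (f ⊗ g) ≋ ρ u f ⊗ g ⊕ f ⊗ ρ u g)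
      (λ a f g → ≋-trans (⊗-zeroˡ _) (≋-sym (≋-trans
        (⊕-cong (≋-trans (⊗-cong (⊗-zeroˡ f) ≋-refl) (⊗-zeroˡ g))
                (≋-trans (⊗-cong ≋-refl (⊗-zeroˡ g)) (⊗-zeroʳ f))) (⊕-identityˡ _))))
      (λ k f g → solve 6 (λ x y f g f′ g′ → x :* (y :* (f′ :* g :+ f :* g′)) :=
          (x :* (y :* f′)) :* g :+ f :* (x :* (y :* g′)))
        ≋-refl (con (β t k)) (con (γ k)) f g (∂ k f) (∂ k g))

    b-scalar : ∀ a x → ρ (b a) (con x) ≋ con 0#
    b-scalar = b-coeff-elim t (λ a u → ∀ x → ρ u (con x) ≋ con 0#) (λ a x → ⊗-zeroˡ _)
      (λ k x → ≋-trans (⊗-cong ≋-refl (⊗-zeroʳ _)) (⊗-zeroʳ _))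

    b-generator : ∀ a j → ∃[ x ] ρ (b a) (p j) ≋ con x
    b-generator = b-coeff-elim t (λ a u → ∀ j → ∃[ x ] ρ u (p j) ≋ con x)
      (λ a j → 0# , ⊗-zeroˡ _)
      (λ k j → _ , ≋-sym (≋-trans (con-* (β t k) _) (⊗-cong ≋-refl (con-* (γ k) _))))

    b-orthogonal-p : ∀ a j → a ≢ odd j → ρ (b a) (p j) ≋ con 0#
    b-orthogonal-p = b-coeff-elim t (λ a u → ∀ j → a ≢ odd j → ρ u (p j) ≋ con 0#)
      (λ a j _ → ⊗-zeroˡ _)
      (λ k j k≢j → ≋-trans (⊗-cong ≋-refl (≋-trans
        (⊗-cong ≋-refl (∂-other {k} {j} (k≢j ∘ ≡.cong odd))) (⊗-zeroʳ _))) (⊗-zeroʳ _))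

    b-translation : IsTranslation b
    b-translation = record
      { b₀            = ≋-refl
      ; derivation    = b-derivation
      ; scalar        = b-scalar
      ; generator     = b-generator
      ; generator-top = λ a k k<a → b-orthogonal-p a k (ℕ.>⇒≢ k<a)
      }

    open Translation K char0 b b-translation public

    module _ (s : Parameter) where

      -- The operators ρ (b i) and the coefficients a-coeff s j pair diagonally, and the
      -- result is the logarithm of F_{t,s}.
      contraction : ∀ a → ρ (b a) (a-coeff s a) ≋ con (logF-coeff t s a)
      contraction a = ≋-trans
        ([ (λ even → ≡.subst₂ (λ u v → ρ (b a) u ≋ v) (≡.sym (even _)) (≡.sym (even _)) (b-scalar a 0#))
         , (λ (k , _ , eq) → ≡.subst₂ (λ (u , v) w → ρ u v ≋ w)
             (≡.sym (≡.cong₂ _,_ (eq _) (eq _))) (≡.sym (eq _)) (diagonal k))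
         ]′ (oddSeries-coefficient a))
        (≋-sym (con-oddSeries a))
        where
        con-oddSeries : ∀ n → con (logF-coeff t s n) ≋ ΓSeries.oddSeries (con ∘ logF t s) n
        con-oddSeries = Scalar.oddSeries-∼ (λ k → ≋-refl)

        diagonal : ∀ k → ρ (con (β t k) ⊗ (con (γ k) ⊗ p k)) (con (α s k) ⊗ p k) ≋ con (logF t s k)
        diagonal k = begin
          con (β t k) ⊗ (con (γ k) ⊗ ∂ k (con (α s k) ⊗ p k))
            ≈⟨ ⊗-cong ≋-refl (⊗-cong ≋-refl (∂-scalar k _ _)) ⟩
          con (β t k) ⊗ (con (γ k) ⊗ (con (α s k) ⊗ ∂ k (p k)))
            ≈⟨ ⊗-cong ≋-refl (⊗-cong ≋-refl (≋-trans (⊗-cong ≋-refl (∂-same k)) (⊗-identityʳ _))) ⟩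
          con (β t k) ⊗ (con (γ k) ⊗ con (α s k))
            ≈⟨ ≋-trans (⊗-cong ≋-refl (≋-sym (con-* _ _))) (≋-sym (con-* _ _)) ⟩
          con (β t k * (γ k * α s k))
            ≈⟨ con-cong (β*γ*α t s k) ⟩
          con (logF t s k)
            ∎

      orthogonal : ∀ a i → a ≢ i → ρ (b a) (a-coeff s i) ≋ con 0#
      orthogonal a i a≢i =
        [ (λ even → ≡.subst (λ u → ρ (b a) u ≋ con 0#) (≡.sym (even _)) (b-scalar a 0#))
        , (λ (k , i≡odd , eq) → ≡.subst (λ u → ρ (b a) u ≋ con 0#) (≡.sym (eq _)) (begin
            ρ (b a) (con (α s k) ⊗ p k)   ≈⟨ ρ-scalar (b a) _ _ ⟩
            con (α s k) ⊗ ρ (b a) (p k)   ≈⟨ ⊗-cong ≋-refl (b-orthogonal-p a k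
                                               (λ a≡odd → a≢i (≡.trans a≡odd (≡.sym i≡odd)))) ⟩
            con (α s k) ⊗ con 0#          ≈⟨ ⊗-zeroʳ _ ⟩
            con 0#                        ∎))
        ]′ (oddSeries-coefficient i)

  -- The coefficient of zⁿ in e^{A_t(z)}, as an element of Γ.
  E : Parameter → ℕ → Γ
  E t = exp₁ (a-coeff t)

  D-E : ∀ t s j n → D t j (E s n) ≋ exp₁ (con ∘ logF-coeff t s) j ⊗ shift j (E s) n
  D-E t s = D-exp t (a-coeff s) ≋-refl (logF-coeff t s) 𝕂.refl (contraction t s) (orthogonal t s)

module Coefficients {c ℓ₁ ℓ₂} (K : HeytingField c ℓ₁ ℓ₂) (char0 : CharacteristicZero K) where

  open VertexOperators K char0 public
  open SetoidReasoning ΓR.setoid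

  private
    Γ-raw = CommutativeSemiring.rawSemiring Γ-semiring

    multiplication-compatible : Compatible rawOp Γ-raw (λ S k → 1/! k • S) (λ f k → con (1/! k) ⊗ f)
      (λ S u → ∀ f → S f ≋ u ⊗ f)
    multiplication-compatible = record
      { ∼-0  = λ f → ≋-sym (⊗-zeroˡ f)
      ; ∼-1  = λ f → ≋-sym (⊗-identityˡ f)
      ; ∼-+  = λ S T f → ≋-trans (⊕-cong (S f) (T f)) (≋-sym (⊗-distribʳ f _ _))
      ; ∼-*  = λ S T f → ≋-trans (S _) (≋-trans (⊗-cong ≋-refl (T f)) (≋-sym (⊗-assoc _ _ f)))
      ; ∼-/! = λ k S f → ≋-trans (⊗-cong ≋-refl (S f)) (≋-sym (⊗-assoc _ _ f))
      }

    differentiation-compatible : Compatible rawOp Γ-raw (λ S k → 1/! k • S) (λ f k → con (1/! k) ⊗ f)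
      (λ S u → ∀ f → S f ≋ ρ u f)
    differentiation-compatible = record
      { ∼-0  = λ f → ≋-sym (⊗-zeroˡ f)
      ; ∼-1  = λ f → ≋-sym (⊗-identityˡ f)
      ; ∼-+  = λ S T f → ⊕-cong (S f) (T f)
      ; ∼-*  = λ {S} {u} S∼u T∼v f → ≋-trans (S∼u _) (ρ-congʳ u (T∼v f))
      ; ∼-/! = λ k S f → ⊗-cong ≋-refl (S f)
      }

    -- The actions of Γ on itself by multiplication and by differential operators.
    module Multiplication  = Transfer _ _ _ _ _ multiplication-compatible
    module Differentiation = Transfer _ _ _ _ _ differentiation-compatible

  -- Coefficients at integers, those at negative integers being zero.
  ext : (ℕ → Γ) → ℤ → Γ
  ext x (+ n)    = x n
  ext x -[1+ n ] = con 0#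

  ext-⊖ : ∀ x n j → ext x (n ℤ.⊖ j) ≡ shift j x n
  ext-⊖ x n       zero    = ≡.refl
  ext-⊖ x zero    (suc j) = ≡.refl
  ext-⊖ x (suc n) (suc j) = ≡.trans (≡.cong (ext x) (ℤ.[1+m]⊖[1+n]≡m⊖n n j)) (ext-⊖ x n j)

  ext-shift : ∀ x n j → ext x (+ n ℤ.- + j) ≡ shift j x n
  ext-shift x n j = ≡.trans (≡.cong (ext x) (ℤ.m-n≡m⊖n n j)) (ext-⊖ x n j)

  ext-negative : ∀ x n j → ext x (-[1+ n ] ℤ.- + j) ≡ con 0#
  ext-negative x n zero    = ≡.refl
  ext-negative x n (suc j) = ≡.refl

  shift-vanishes : ∀ x {n j} → n < j → shift j x n ≡ con 0#
  shift-vanishes x {zero}  {suc j} _         = ≡.refl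
  shift-vanishes x {suc n} {suc j} (s≤s n<j) = shift-vanishes x n<j

  ext-vanishes : ∀ x d {j} → ℤ.∣ d ∣ < j → ext x (d ℤ.- + j) ≡ con 0#
  ext-vanishes x (+ n)    {j} n<j = ≡.trans (ext-shift x n j) (shift-vanishes x n<j)
  ext-vanishes x -[1+ n ] {j} _   = ext-negative x n j

  -- The coefficient of z^d in e^{A_t(z)}, for an integer d.
  Eℤ : Parameter → ℤ → Γ
  Eℤ t = ext (E t)

  -- F_{t,s} as an exponential computed in Γ.
  F-exp : ∀ t s n → con (F t s n) ≋ exp₁ (con ∘ logF-coeff t s) n
  F-exp t s n = ≋-trans
    (Scalar.exp-∼ (Scalar.inVariable-∼ zero {logF-coeff t s} (λ n → ≋-refl)) (n ∷ []))
    (exp₁-def (con ∘ logF-coeff t s) n)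

  -- The coefficients of e^{B_t(z)}(e^{A_s(w)}) = F_{t,s}(w/z) e^{A_s(w)}.
  D-Eℤ : ∀ t s j d → D t j (Eℤ s d) ≋ con (F t s j) ⊗ Eℤ s (d ℤ.- + j)
  D-Eℤ t s j (+ n)    = ≋-trans (D-E t s j n)
    (⊗-cong (≋-sym (F-exp t s j)) (ΓR.reflexive (≡.sym (ext-shift (E s) n j))))
  D-Eℤ t s j -[1+ n ] = ≋-trans (ρ-0 (exp₁ (b-coeff t) j)) (≋-sym (≋-trans
    (⊗-cong ≋-refl (ΓR.reflexive (ext-negative (E s) n j))) (⊗-zeroʳ _)))

  -- The coefficients of e^{A_{t₁}(z₁)} ⋯ e^{A_{tᵣ}(zᵣ)} and e^{B_{t₁}(z₁)} ⋯ e^{B_{tᵣ}(zᵣ)}.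
  𝐄 : ∀ {r} → Vec Parameter r → Vec ℤ r → Γ
  𝐄 []       []       = con 1#
  𝐄 (t ∷ ts) (d ∷ ds) = Eℤ t d ⊗ 𝐄 ts ds

  𝐃 : ∀ {r} → Vec Parameter r → Vec ℕ r → Op
  𝐃 []       []      f = f
  𝐃 (t ∷ ts) (n ∷ l) f = D t n (𝐃 ts l f)

  𝐃-ρ : ∀ {r} (ts : Vec Parameter r) l f → ρ (∏exp₁ (b-coeff ∘ Vec.lookup ts) l) f ≋ 𝐃 ts l f
  𝐃-ρ []       []      f = ⊗-identityˡ f
  𝐃-ρ (t ∷ ts) (n ∷ l) f = ρ-congʳ (exp₁ (b-coeff t) n) (𝐃-ρ ts l f)

  extend-⊗ : ∀ {r} u (S : ΓSeries.Series r) d →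
             ΓSeries.extend (λ m → u ⊗ S m) d ≋ u ⊗ ΓSeries.extend S d
  extend-⊗ u S []             = ≋-refl
  extend-⊗ u S (+ n      ∷ d) = extend-⊗ u (S ∘ (n ∷_)) d
  extend-⊗ u S (-[1+ n ] ∷ d) = ≋-sym (⊗-zeroʳ u)

  extend-∏exp₁ : ∀ {r} (ts : Vec Parameter r) d →
                 ΓSeries.extend (∏exp₁ (a-coeff ∘ Vec.lookup ts)) d ≋ 𝐄 ts d
  extend-∏exp₁ []       []             = ≋-refl
  extend-∏exp₁ (t ∷ ts) (+ n      ∷ d) =
    ≋-trans (extend-⊗ (E t n) (∏exp₁ (a-coeff ∘ Vec.lookup ts)) d) (⊗-cong ≋-refl (extend-∏exp₁ ts d))
  extend-∏exp₁ (t ∷ ts) (-[1+ n ] ∷ d) = ≋-sym (⊗-zeroˡ _)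

  A-coefficient : ∀ t n f → A t n f ≋ a-coeff t n ⊗ f
  A-coefficient t = Multiplication.oddSeries-∼ (λ k f → ≋-sym (⊗-assoc _ _ f))

  B-coefficient : ∀ t n f → B t n f ≋ ρ (b-coeff t n) f
  B-coefficient t = Differentiation.oddSeries-∼ (λ k f → ≋-refl)

  𝒴-term : ∀ t d n f →
    OpSeries.extend (OpSeries.exp (OpSeries.inVariable zero (A t))) (d ∷ [])
      (OpSeries.exp (OpSeries.inVariable zero (B t)) (n ∷ []) f) ≋ Eℤ t d ⊗ D t n f
  𝒴-term t d n f = ≋-trans
    (Multiplication.extend-∼ (Multiplication.exp-∼ (Multiplication.inVariable-∼ zero (A-coefficient t)))
      (d ∷ []) _)
    (⊗-cong (coefficient d)
      (≋-trans (Differentiation.exp-∼ (Differentiation.inVariable-∼ zero (B-coefficient t)) (n ∷ []) f)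
               (ρ-congˡ (exp₁-def (b-coeff t) n) f)))
    where
    coefficient : ∀ d → ΓSeries.extend (ΓSeries.exp (ΓSeries.inVariable zero (a-coeff t))) (d ∷ []) ≋ Eℤ t d
    coefficient (+ n)    = exp₁-def (a-coeff t) n
    coefficient -[1+ n ] = ≋-refl

  normallyOrdered-term : ∀ {r} (ts : Vec Parameter r) d l f →
    OpSeries.extend
      (OpSeries.exp λ m → OpSeries.∑ (allFin r) λ i → OpSeries.inVariable i (A (Vec.lookup ts i)) m) d
      (OpSeries.exp (λ m → OpSeries.∑ (allFin r) λ i → OpSeries.inVariable i (B (Vec.lookup ts i)) m) l f)
    ≋ 𝐄 ts d ⊗ 𝐃 ts l f
  normallyOrdered-term {r} ts d l f = ≋-trans
    (Multiplication.extend-∼ {S′ = ∏exp₁ (a-coeff ∘ Vec.lookup ts)} exp-A d _)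
    (⊗-cong (extend-∏exp₁ ts d) (≋-trans
      (Differentiation.exp-∼ {S′ = total (b-coeff ∘ Vec.lookup ts)} (λ m → Differentiation.∑-∼ (allFin r)
        (λ i → Differentiation.inVariable-∼ i (B-coefficient (Vec.lookup ts i)) m)) l f)
      (≋-trans (ρ-congˡ (exp-total (b-coeff ∘ Vec.lookup ts) (λ i → ≋-refl) l) f) (𝐃-ρ ts l f))))
    where
    exp-A : ∀ m f → _ ≋ ∏exp₁ (a-coeff ∘ Vec.lookup ts) m ⊗ f
    exp-A m f = ≋-trans
      (Multiplication.exp-∼ {S′ = total (a-coeff ∘ Vec.lookup ts)} (λ m → Multiplication.∑-∼ (allFin r)
        (λ i → Multiplication.inVariable-∼ i (A-coefficient (Vec.lookup ts i)) m)) m f)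
      (⊗-cong (exp-total (a-coeff ∘ Vec.lookup ts) (λ i → ≋-refl) m) ≋-refl)

  D-0# : ∀ t j → D t j (con 0#) ≋ con 0#
  D-0# t j = ρ-0 (exp₁ (b-coeff t) j)

  D-cong : ∀ t j {f g} → f ≋ g → D t j f ≋ D t j g
  D-cong t j = ρ-congʳ (exp₁ (b-coeff t) j)

  D-additive : ∀ t j → Additive (D t j)
  D-additive t j = ρ-additive (exp₁ (b-coeff t) j)

  D-con : ∀ t j x f → D t j (con x ⊗ f) ≋ con x ⊗ D t j f
  D-con t j = ρ-scalar (exp₁ (b-coeff t) j)

  𝐃-0# : ∀ {r} (ts : Vec Parameter r) l → 𝐃 ts l (con 0#) ≋ con 0#
  𝐃-0# []       []      = ≋-refl
  𝐃-0# (t ∷ ts) (n ∷ l) = ≋-trans (D-cong t n (𝐃-0# ts l)) (D-0# t n)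

  𝐃-cong : ∀ {r} (ts : Vec Parameter r) l {f g} → f ≋ g → 𝐃 ts l f ≋ 𝐃 ts l g
  𝐃-cong []       []      f≋g = f≋g
  𝐃-cong (t ∷ ts) (n ∷ l) f≋g = D-cong t n (𝐃-cong ts l f≋g)

  D-𝐃-comm : ∀ {r} t n (ts : Vec Parameter r) l f → D t n (𝐃 ts l f) ≋ 𝐃 ts l (D t n f)
  D-𝐃-comm t n []       []      f = ≋-refl
  D-𝐃-comm t n (s ∷ ts) (m ∷ l) f = ≋-trans
    (ρ-comm (exp₁ (b-coeff t) n) (exp₁ (b-coeff s) m) _) (D-cong s m (D-𝐃-comm t n ts l f))

  𝐃-∷-vanishes : ∀ {r} t n (ts : Vec Parameter r) l f → D t n f ≋ con 0# → 𝐃 (t ∷ ts) (n ∷ l) f ≋ con 0#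
  𝐃-∷-vanishes t n ts l f Df≋0 = begin
    D t n (𝐃 ts l f)    ≈⟨ D-𝐃-comm t n ts l f ⟩
    𝐃 ts l (D t n f)    ≈⟨ 𝐃-cong ts l Df≋0 ⟩
    𝐃 ts l (con 0#)     ≈⟨ 𝐃-0# ts l ⟩
    con 0#              ∎

  𝐃-vanishes : ∀ {r} (ts : Vec Parameter r) l f → 𝐃 ts l f ≋ con 0# ⊎ All (_< suc (degree f)) l
  𝐃-vanishes []       []      f = inj₂ []
  𝐃-vanishes (t ∷ ts) (n ∷ l) f = cases (ℕ.<-≤-connex (degree f) n) (𝐃-vanishes ts l f)
    where
    cases : degree f < n ⊎ n ≤ degree f → 𝐃 ts l f ≋ con 0# ⊎ All (_< suc (degree f)) l →
            𝐃 (t ∷ ts) (n ∷ l) f ≋ con 0# ⊎ All (_< suc (degree f)) (n ∷ l)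
    cases (inj₁ f<n) _            = inj₁ (𝐃-∷-vanishes t n ts l f (D-degree t f n f<n))
    cases (inj₂ n≤f) (inj₁ 𝐃f≋0) = inj₁ (≋-trans (D-cong t n 𝐃f≋0) (D-0# t n))
    cases (inj₂ n≤f) (inj₂ l≤f)  = inj₂ (s≤s n≤f ∷ l≤f)

-- Normal ordering

module Ordering {c ℓ₁ ℓ₂} (K : HeytingField c ℓ₁ ℓ₂) (char0 : CharacteristicZero K) where

  open Coefficients K char0
  open Boxes Γ-semiring
  open SetoidReasoning ΓR.setoid
  open Solver Γ-semiring using (solve; _:=_; _:*_)

  -- The coefficient of ∏ⱼ (zⱼ/z)^(row j) in ∏ⱼ F_{t,tⱼ}(zⱼ/z).
  ∏F-row : ∀ {r} → Parameter → Vec Parameter r → Vec ℕ r → Carrier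
  ∏F-row t ts row = Vec.foldr _ _*_ 1# (Vec.zipWith (F t) ts row)

  𝐄-nonnegative : ∀ {r} (ts : Vec Parameter r) d → 𝐄 ts d ≋ con 0# ⊎ All (+ 0 ℤ.≤_) d
  𝐄-nonnegative []       []             = inj₂ []
  𝐄-nonnegative (t ∷ ts) (+ n ∷ d)      =
    Sum.map (λ 𝐄≋0 → ≋-trans (⊗-cong ≋-refl 𝐄≋0) (⊗-zeroʳ _)) (ℤ.+≤+ z≤n ∷_) (𝐄-nonnegative ts d)
  𝐄-nonnegative (t ∷ ts) (-[1+ n ] ∷ d) = inj₁ (⊗-zeroˡ _)

  𝐄-÷-bounded : ∀ {r C M} (ts : Vec Parameter r) d n → All (ℤ._≤ + C) d → r ℕ.* C < M →
                𝐄 ts (d ÷ n) ≋ con 0# ⊎ TriangleBounded M n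
  𝐄-÷-bounded ts d n d≤C rC<M =
    Sum.map₂ (÷-bounded d n d≤C rC<M) (𝐄-nonnegative ts (d ÷ n))

  D-Eℤ-⊗ : ∀ t s d f l →
    D t l (Eℤ s d ⊗ f) ≋ conv (λ i k → con (F t s i) ⊗ Eℤ s (d ℤ.- + i) ⊗ D t k f) l
  D-Eℤ-⊗ t s d f l = ≋-trans (D-⊗ t l (Eℤ s d) f)
    (conv-cong′ l (λ i k → ⊗-cong (D-Eℤ t s i d) ≋-refl))

  -- Moving e^{B_t(z)} past e^{A_s(w)}, and below past e^{A_{t₁}(z₁)} ⋯ e^{A_{tᵣ}(zᵣ)}. The
  -- weights ψ l stand for the coefficients of e^{A_t(z)}, by which those of e^{B_t(z)} are
  -- multiplied in 𝒴(z;t); their shift accounts for the powers of 1/z.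
  reorder-∷ : ∀ t s d f → Eventually λ N → ∀ (ψ : ℕ → Γ) →
    ∑ (upTo N) (λ l → ψ l ⊗ D t l (Eℤ s d ⊗ f)) ≋
    ∑ (upTo N) (λ i → con (F t s i) ⊗ Eℤ s (d ℤ.- + i) ⊗ ∑ (upTo N) (λ k → ψ (i ℕ.+ k) ⊗ D t k f))
  reorder-∷ t s d f = suc ℤ.∣ d ∣ ℕ.+ suc (degree f) , λ {N} M≤N ψ →
    let
      G = λ i → con (F t s i) ⊗ Eℤ s (d ℤ.- + i)
      φ = λ i k → ψ (i ℕ.+ k) ⊗ (G i ⊗ D t k f)

      φ≋0ˡ : ∀ i k → suc ℤ.∣ d ∣ ≤ i → φ i k ≋ con 0#
      φ≋0ˡ i k d<i = ≋-trans (⊗-cong ≋-refl (≋-trans (⊗-cong (≋-trans (⊗-cong ≋-refl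
        (ΓR.reflexive (ext-vanishes (E s) d d<i))) (⊗-zeroʳ _)) ≋-refl) (⊗-zeroˡ _))) (⊗-zeroʳ _)

      φ≋0ʳ : ∀ i k → suc (degree f) ≤ k → φ i k ≋ con 0#
      φ≋0ʳ i k f<k = ≋-trans (⊗-cong ≋-refl (≋-trans (⊗-cong ≋-refl (D-degree t f k f<k)) (⊗-zeroʳ _)))
        (⊗-zeroʳ _)
    in begin
    ∑ (upTo N) (λ l → ψ l ⊗ D t l (Eℤ s d ⊗ f))
      ≈⟨ ∑-cong (upTo N) (λ l → ≋-trans (⊗-cong ≋-refl (D-Eℤ-⊗ t s d f l)) (≋-trans (conv-*ˡ (ψ l) _ l)
           (conv-cong l (λ i k i+k≡l → ⊗-cong (ΓR.reflexive (≡.cong ψ (≡.sym i+k≡l))) ≋-refl)))) ⟩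
    ∑ (upTo N) (conv φ)
      ≈⟨ ∑-conv φ (suc ℤ.∣ d ∣) (suc (degree f)) (ℕ.m≤n⇒m≤1+n M≤N) φ≋0ˡ φ≋0ʳ ⟩
    ∑ (upTo (suc ℤ.∣ d ∣)) (λ i → ∑ (upTo (suc (degree f))) (φ i))
      ≈⟨ ∑-extend (λ i → ∑ (upTo (suc (degree f))) (φ i)) (ℕ.≤-trans (ℕ.m≤m+n _ _) M≤N)
           (λ i d<i → ∑-zero (upTo (suc (degree f))) (λ k → φ≋0ˡ i k d<i)) ⟨
    ∑ (upTo N) (λ i → ∑ (upTo (suc (degree f))) (φ i))
      ≈⟨ ∑-cong (upTo N) (λ i → ∑-extend (φ i) (ℕ.≤-trans (ℕ.m≤n+m _ (suc ℤ.∣ d ∣)) M≤N) (φ≋0ʳ i)) ⟨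
    ∑ (upTo N) (λ i → ∑ (upTo N) (φ i))
      ≈⟨ ∑-cong (upTo N) (λ i → ∑-cong (upTo N) (λ k →
           solve 3 (λ x y z → x :* (y :* z) := y :* (x :* z)) ≋-refl (ψ (i ℕ.+ k)) (G i) (D t k f))) ⟩
    ∑ (upTo N) (λ i → ∑ (upTo N) (λ k → G i ⊗ (ψ (i ℕ.+ k) ⊗ D t k f)))
      ≈⟨ ∑-cong (upTo N) (λ i → ≋-sym (∑-*ˡ (G i) (upTo N) _)) ⟩
    ∑ (upTo N) (λ i → G i ⊗ ∑ (upTo N) (λ k → ψ (i ℕ.+ k) ⊗ D t k f))
      ∎

  Reordered : ∀ {r} → Parameter → Vec Parameter r → Vec ℤ r → Γ → ℕ → Set (c ⊔ ℓ₁)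
  Reordered {r} t ts q f N = ∀ (ψ : ℕ → Γ) →
    ∑ (upTo N) (λ l → ψ l ⊗ D t l (𝐄 ts q ⊗ f)) ≋
    ∑ (box N r) (λ row → con (∏F-row t ts row) ⊗
      (𝐄 ts (q ⊟ row) ⊗ ∑ (upTo N) (λ l → ψ (Vec.sum row ℕ.+ l) ⊗ D t l f)))

  reorder : ∀ {r} t (ts : Vec Parameter r) q f → Eventually (Reordered t ts q f)
  reorder t []       []       f = 0 , λ {N} _ ψ → ≋-sym (begin
    con 1# ⊗ (con 1# ⊗ ∑ (upTo N) (λ l → ψ l ⊗ D t l f)) ⊕ con 0#
      ≈⟨ ≋-trans (⊕-identityʳ _) (≋-trans (⊗-identityˡ _) (⊗-identityˡ _)) ⟩
    ∑ (upTo N) (λ l → ψ l ⊗ D t l f)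
      ≈⟨ ∑-cong (upTo N) (λ l → ⊗-cong ≋-refl (D-cong t l (≋-sym (⊗-identityˡ f)))) ⟩
    ∑ (upTo N) (λ l → ψ l ⊗ D t l (con 1# ⊗ f))
      ∎)
  reorder {suc r} t (s ∷ ts) (d ∷ q) f =
    combine (reorder-∷ t s d (𝐄 ts q ⊗ f)) (reorder t ts q f)
    where
    combine : Eventually (λ N → ∀ (ψ : ℕ → Γ) →
                ∑ (upTo N) (λ l → ψ l ⊗ D t l (Eℤ s d ⊗ (𝐄 ts q ⊗ f))) ≋
                ∑ (upTo N) (λ i → con (F t s i) ⊗ Eℤ s (d ℤ.- + i) ⊗
                  ∑ (upTo N) (λ k → ψ (i ℕ.+ k) ⊗ D t k (𝐄 ts q ⊗ f)))) →
              Eventually (Reordered t ts q f) →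
              Eventually (Reordered t (s ∷ ts) (d ∷ q) f)
    combine (M , first) (M′ , others) = M ℕ.⊔ M′ , λ {N} M≤N ψ →
      let
        G = λ i → con (F t s i) ⊗ Eℤ s (d ℤ.- + i)
        H = λ i row → ∑ (upTo N) (λ l → ψ (i ℕ.+ (Vec.sum row ℕ.+ l)) ⊗ D t l f)
      in begin
      ∑ (upTo N) (λ l → ψ l ⊗ D t l (Eℤ s d ⊗ 𝐄 ts q ⊗ f))
        ≈⟨ ∑-cong (upTo N) (λ l → ⊗-cong ≋-refl (D-cong t l (⊗-assoc _ _ _))) ⟩
      ∑ (upTo N) (λ l → ψ l ⊗ D t l (Eℤ s d ⊗ (𝐄 ts q ⊗ f)))
        ≈⟨ first (ℕ.≤-trans (ℕ.m≤m⊔n M M′) M≤N) ψ ⟩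
      ∑ (upTo N) (λ i → G i ⊗ ∑ (upTo N) (λ k → ψ (i ℕ.+ k) ⊗ D t k (𝐄 ts q ⊗ f)))
        ≈⟨ ∑-cong (upTo N) (λ i → ⊗-cong ≋-refl
             (others (ℕ.≤-trans (ℕ.m≤n⊔m M M′) M≤N) (λ k → ψ (i ℕ.+ k)))) ⟩
      ∑ (upTo N) (λ i → G i ⊗ ∑ (box N r) (λ row → con (∏F-row t ts row) ⊗ (𝐄 ts (q ⊟ row) ⊗ H i row)))
        ≈⟨ ∑-cong (upTo N) (λ i → ∑-*ˡ (G i) (box N r) _) ⟩
      ∑ (upTo N) (λ i → ∑ (box N r) (λ row → G i ⊗ (con (∏F-row t ts row) ⊗ (𝐄 ts (q ⊟ row) ⊗ H i row))))
        ≈⟨ ∑-cong (upTo N) (λ i → ∑-cong (box N r) (λ row →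
             solve 5 (λ x e y e′ h → x :* e :* (y :* (e′ :* h)) := x :* y :* (e :* e′ :* h)) ≋-refl
               (con (F t s i)) (Eℤ s (d ℤ.- + i)) (con (∏F-row t ts row)) (𝐄 ts (q ⊟ row)) (H i row))) ⟩
      ∑ (upTo N) (λ i → ∑ (box N r) (λ row → con (F t s i) ⊗ con (∏F-row t ts row) ⊗
        (𝐄 (s ∷ ts) ((d ∷ q) ⊟ (i ∷ row)) ⊗ H i row)))
        ≈⟨ ∑-cong (upTo N) (λ i → ∑-cong (box N r) (λ row → ⊗-cong (≋-sym (con-* _ _))
             (⊗-cong ≋-refl (∑-cong (upTo N) (λ l →
               ⊗-cong (ΓR.reflexive (≡.cong ψ (≡.sym (ℕ.+-assoc i (Vec.sum row) l)))) ≋-refl))))) ⟩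
      ∑ (upTo N) (λ i → ∑ (box N r) (λ row → con (∏F-row t (s ∷ ts) (i ∷ row)) ⊗
        (𝐄 (s ∷ ts) ((d ∷ q) ⊟ (i ∷ row)) ⊗
          ∑ (upTo N) (λ l → ψ (Vec.sum (i ∷ row) ℕ.+ l) ⊗ D t l f))))
        ≈⟨ ∑-product _∷_ (upTo N) (box N r) _ ⟨
      ∑ (box N (suc r)) (λ row → con (∏F-row t (s ∷ ts) row) ⊗
        (𝐄 (s ∷ ts) ((d ∷ q) ⊟ row) ⊗ ∑ (upTo N) (λ l → ψ (Vec.sum row ℕ.+ l) ⊗ D t l f)))
        ∎

  -- The value on f of the coefficient of z^d in 𝒴(z₁;t₁) ⋯ 𝒴(zᵣ;tᵣ). The operators D t l
  -- with l > degree h do not contribute.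
  productValue : ∀ {r} → Vec Parameter r → Vec ℤ r → Γ → Γ
  productValue []       []       f = f
  productValue (t ∷ ts) (d ∷ ds) f =
    ∑ (upTo (suc (degree h))) (λ l → Eℤ t (d ℤ.+ + l) ⊗ D t l h)
    where
    h = productValue ts ds f

  -- The summands of the value on f of the coefficient of z^d in the normally ordered
  -- product, and their sum over a box.
  orderedTerm : ∀ {r} → Vec Parameter r → Vec ℤ r → Γ → Vec ℕ r → Γ
  orderedTerm ts d f l = 𝐄 ts (d ⊞ l) ⊗ 𝐃 ts l f

  orderedValue : ∀ {r} → ℕ → Vec Parameter r → Vec ℤ r → Γ → Γ
  orderedValue {r} N ts d f = ∑ (box N r) (orderedTerm ts d f)

  orderedTerm-bounded : ∀ {r} (ts : Vec Parameter r) d f l →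
                        orderedTerm ts d f l ≋ con 0# ⊎ Bounded (suc (degree f)) l
  orderedTerm-bounded ts d f l =
    Sum.map₁ (λ 𝐃≋0 → ≋-trans (⊗-cong ≋-refl 𝐃≋0) (⊗-zeroʳ _)) (𝐃-vanishes ts l f)

  -- The value on f of the coefficient of z^d in the product of ∏F ts with the normally
  -- ordered product, with all sums over boxes with side N.
  productSum : ∀ {r} → Vec Parameter r → Vec ℤ r → Γ → ℕ → Γ
  productSum {r} ts d f N =
    ∑ (triangles N r) (λ n → con (∏F ts n) ⊗ orderedValue N ts (d ÷ n) f)

  -- If an entry of n is not below this bound, then the coefficient of z^(d ÷ n) in the
  -- normally ordered product vanishes on f: its summands have l ≤ degree f, so that the
  -- entries of d ⊞ l are at most the constant in parentheses.
  triangleBound : ∀ {r} → Vec ℤ r → Γ → ℕ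
  triangleBound {r} d f = suc (r ℕ.* (Vec.sum (Vec.map ℤ.∣_∣ d) ℕ.+ suc (degree f)))

  -- The induction step: the sum for ts over boxes with the fixed side M is substituted into
  -- 𝒴(z;t), e^{B_t(z)} is moved to the right with sums over boxes with large side N, and
  -- finally the sides M are enlarged to N.
  module Step {r} (t : Parameter) (ts : Vec Parameter r) (d : ℤ) (ds : Vec ℤ r) (f : Γ)
    (M : ℕ) (f<M : suc (degree f) ≤ M) (bound≤M : triangleBound ds f ≤ M)
    (IH : productSum ts ds f M ≋ productValue ts ds f) where

    h = productValue ts ds f

    -- A triangle for t ∷ ts consists of a row for t and a triangle n for ts, and a
    -- multi-index of l and l′. For given row, n and l′, the sum over l < N of the terms in the
    -- coefficient of z^(d ∷ ds) is Z N row n l′.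
    ψ : ℕ → Γ
    ψ l = Eℤ t (d ℤ.+ + l)

    q : Triangle r → Vec ℕ r → Vec ℤ r
    q n l′ = (ds ÷ n) ⊞ l′

    Y : Triangle r → Vec ℕ r → Γ
    Y n l′ = 𝐄 ts (q n l′) ⊗ 𝐃 ts l′ f

    G : ℕ → Vec ℕ r → Vec ℕ r → Γ
    G N row l′ = ∑ (upTo N) (λ l → ψ (Vec.sum row ℕ.+ l) ⊗ D t l (𝐃 ts l′ f))

    Z : ℕ → Vec ℕ r → Triangle r → Vec ℕ r → Γ
    Z N row n l′ =
      con (∏F ts n) ⊗ (con (∏F-row t ts row) ⊗ (𝐄 ts (q n l′ ⊟ row) ⊗ G N row l′))

    h-expanded : h ≋ ∑ (triangles M r) (λ n → ∑ (box M r) (λ l′ → con (∏F ts n) ⊗ Y n l′))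
    h-expanded = ≋-trans (≋-sym IH)
      (∑-cong (triangles M r) (λ n → ∑-*ˡ (con (∏F ts n)) (box M r) (Y n)))

    summand-expanded : ∀ l → ψ l ⊗ D t l h ≋
      ∑ (triangles M r) (λ n → ∑ (box M r) (λ l′ → con (∏F ts n) ⊗ (ψ l ⊗ D t l (Y n l′))))
    summand-expanded l = begin
      ψ l ⊗ D t l h
        ≈⟨ ⊗-cong ≋-refl (D-cong t l h-expanded) ⟩
      ψ l ⊗ D t l (∑ (triangles M r) (λ n → ∑ (box M r) (λ l′ → con (∏F ts n) ⊗ Y n l′)))
        ≈⟨ ⊗-cong ≋-refl (≋-trans (∑-additive (D-additive t l) (triangles M r) _)
             (∑-cong (triangles M r) (λ n → ≋-trans (∑-additive (D-additive t l) (box M r) _)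
               (∑-cong (box M r) (λ l′ → D-con t l (∏F ts n) (Y n l′)))))) ⟩
      ψ l ⊗ ∑ (triangles M r) (λ n → ∑ (box M r) (λ l′ → con (∏F ts n) ⊗ D t l (Y n l′)))
        ≈⟨ ≋-trans (∑-*ˡ (ψ l) (triangles M r) _)
             (∑-cong (triangles M r) (λ n → ≋-trans (∑-*ˡ (ψ l) (box M r) _)
               (∑-cong (box M r) (λ l′ → solve 3 (λ x y z → x :* (y :* z) := y :* (x :* z)) ≋-refl
                 (ψ l) (con (∏F ts n)) (D t l (Y n l′)))))) ⟩
      ∑ (triangles M r) (λ n → ∑ (box M r) (λ l′ → con (∏F ts n) ⊗ (ψ l ⊗ D t l (Y n l′))))
        ∎

    value-expanded : ∀ {N} → suc (degree h) ≤ N → productValue (t ∷ ts) (d ∷ ds) f ≋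
      ∑ (triangles M r) (λ n → ∑ (box M r) (λ l′ →
        con (∏F ts n) ⊗ ∑ (upTo N) (λ l → ψ l ⊗ D t l (Y n l′))))
    value-expanded {N} h<N = begin
      ∑ (upTo (suc (degree h))) (λ l → ψ l ⊗ D t l h)
        ≈⟨ ∑-extend (λ l → ψ l ⊗ D t l h) h<N
             (λ l h<l → ≋-trans (⊗-cong ≋-refl (D-degree t h l h<l)) (⊗-zeroʳ _)) ⟨
      ∑ (upTo N) (λ l → ψ l ⊗ D t l h)
        ≈⟨ ∑-cong (upTo N) summand-expanded ⟩
      ∑ (upTo N) (λ l → ∑ (triangles M r) (λ n → ∑ (box M r) (λ l′ →
        con (∏F ts n) ⊗ (ψ l ⊗ D t l (Y n l′)))))
        ≈⟨ ≋-trans (∑-swap (upTo N) (triangles M r) _) (∑-cong (triangles M r) (λ n →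
             ≋-trans (∑-swap (upTo N) (box M r) _) (∑-cong (box M r) (λ l′ →
               ≋-sym (∑-*ˡ (con (∏F ts n)) (upTo N) _))))) ⟩
      ∑ (triangles M r) (λ n → ∑ (box M r) (λ l′ →
        con (∏F ts n) ⊗ ∑ (upTo N) (λ l → ψ l ⊗ D t l (Y n l′))))
        ∎

    reordered : Eventually λ N →
      ∑ (triangles M r) (λ n → ∑ (box M r) (λ l′ →
        con (∏F ts n) ⊗ ∑ (upTo N) (λ l → ψ l ⊗ D t l (Y n l′)))) ≋
      ∑ (triangles M r) (λ n → ∑ (box M r) (λ l′ → ∑ (box N r) (λ row → Z N row n l′)))
    reordered = ∑-eventually (triangles M r) (λ n → ∑-eventually (box M r) (λ l′ →
      let M′ , eq = reorder t ts (q n l′) (𝐃 ts l′ f) in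
      M′ , λ {N} M′≤N → ≋-trans (⊗-cong ≋-refl (eq M′≤N ψ)) (∑-*ˡ (con (∏F ts n)) (box N r) _)))

    q-⊟ : ∀ row n l′ → q n l′ ⊟ row ≡ ((ds ⊞ l′) ⊟ row) ÷ n
    q-⊟ row n l′ = ≡.trans (≡.cong (_⊟ row) (minus-plus ds (Vec.map +_ l′) (exponents n)))
      (minus-minus (ds ⊞ l′) (Vec.map +_ row) (exponents n))

    G-bounded : ∀ N row l′ → G N row l′ ≋ con 0# ⊎ Bounded (suc (degree f)) l′
    G-bounded N row l′ = Sum.map₁ (λ 𝐃≋0 → ∑-zero (upTo N) (λ l → ≋-trans
      (⊗-cong ≋-refl (≋-trans (D-cong t l 𝐃≋0) (D-0# t l))) (⊗-zeroʳ _))) (𝐃-vanishes ts l′ f)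

    Z-bounded : ∀ N row n l′ → Z N row n l′ ≋ con 0# ⊎ TriangleBounded M n × Bounded M l′
    Z-bounded N row n l′ = cases (G-bounded N row l′)
      where
      cases : G N row l′ ≋ con 0# ⊎ Bounded (suc (degree f)) l′ →
              Z N row n l′ ≋ con 0# ⊎ TriangleBounded M n × Bounded M l′
      cases (inj₁ G≋0) = inj₁ (≋-trans (⊗-cong ≋-refl (≋-trans (⊗-cong ≋-refl
        (≋-trans (⊗-cong ≋-refl G≋0) (⊗-zeroʳ _))) (⊗-zeroʳ _))) (⊗-zeroʳ _))
      cases (inj₂ l′≤f) = Sum.map
        (λ 𝐄≋0 → ≋-trans (⊗-cong ≋-refl (≋-trans (⊗-cong ≋-refl
          (≋-trans (⊗-cong (≋-trans (ΓR.reflexive (≡.cong (𝐄 ts) (q-⊟ row n l′))) 𝐄≋0) ≋-refl)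
            (⊗-zeroˡ _))) (⊗-zeroʳ _))) (⊗-zeroʳ _))
        (λ n<M → n<M , All.map (λ i<f → ℕ.<-≤-trans i<f f<M) l′≤f)
        (𝐄-÷-bounded ts ((ds ⊞ l′) ⊟ row) n (⊟-≤ row (⊞-≤ ds l′≤f)) bound≤M)

    expand-bounds : ∀ {N} → M ≤ N →
      ∑ (triangles M r) (λ n → ∑ (box M r) (λ l′ → ∑ (box N r) (λ row → Z N row n l′))) ≋
      ∑ (box N r) (λ row → ∑ (triangles N r) (λ n → ∑ (box N r) (λ l′ → Z N row n l′)))
    expand-bounds {N} M≤N = begin
      ∑ (triangles M r) (λ n → ∑ (box M r) (λ l′ → ∑ (box N r) (λ row → Z N row n l′)))
        ≈⟨ ∑-cong (triangles M r) (λ n → ∑-swap (box M r) (box N r) _) ⟩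
      ∑ (triangles M r) (λ n → ∑ (box N r) (λ row → ∑ (box M r) (λ l′ → Z N row n l′)))
        ≈⟨ ∑-cong (triangles M r) (λ n → ∑-cong (box N r) (λ row → ≋-sym
             (∑-box-extend r M≤N (λ l′ → Sum.map₂ proj₂ (Z-bounded N row n l′))))) ⟩
      ∑ (triangles M r) (λ n → ∑ (box N r) (λ row → ∑ (box N r) (λ l′ → Z N row n l′)))
        ≈⟨ ∑-swap (triangles M r) (box N r) _ ⟩
      ∑ (box N r) (λ row → ∑ (triangles M r) (λ n → ∑ (box N r) (λ l′ → Z N row n l′)))
        ≈⟨ ∑-cong (box N r) (λ row → ≋-sym (∑-triangles-extend r M≤N (inner row))) ⟩
      ∑ (box N r) (λ row → ∑ (triangles N r) (λ n → ∑ (box N r) (λ l′ → Z N row n l′)))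
        ∎
      where
      inner : ∀ row n → ∑ (box N r) (Z N row n) ≋ con 0# ⊎ TriangleBounded M n
      inner row n = ∑-zero-or (box N r) (λ l′ → Sum.map₂ proj₁ (Z-bounded N row n l′))

    term-reindexed : ∀ row n l l′ → orderedTerm (t ∷ ts) ((d ∷ ds) ÷ (row , n)) f (l ∷ l′) ≋
      𝐄 ts (q n l′ ⊟ row) ⊗ (ψ (Vec.sum row ℕ.+ l) ⊗ D t l (𝐃 ts l′ f))
    term-reindexed row n l l′ = ≋-trans
      (⊗-cong (ΓR.reflexive
        (≡.cong₂ (λ i j → Eℤ t i ⊗ 𝐄 ts j) (first d (+ Vec.sum row) (+ l)) others)) ≋-refl)
      (solve 3 (λ x y z → x :* y :* z := y :* (x :* z)) ≋-refl _ _ _)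
      where
      first : ∀ d w l → d ℤ.- (ℤ.- w) ℤ.+ l ≡ d ℤ.+ (w ℤ.+ l)
      first = ℤ-Solver.solve-∀

      others : Vec.zipWith ℤ._-_ ds (Vec.zipWith ℤ._+_ (Vec.map +_ row) (exponents n)) ⊞ l′ ≡ q n l′ ⊟ row
      others = ≡.trans (≡.cong (_⊞ l′) (minus-sum ds row (exponents n)))
        (≡.trans (minus-plus (ds ⊟ row) (Vec.map +_ l′) (exponents n))
        (≡.trans (≡.cong (_÷ n) (minus-plus ds (Vec.map +_ l′) (Vec.map +_ row))) (≡.sym (q-⊟ row n l′))))

    sum-reindexed : ∀ N → productSum (t ∷ ts) (d ∷ ds) f N ≋
      ∑ (box N r) (λ row → ∑ (triangles N r) (λ n → ∑ (box N r) (λ l′ → Z N row n l′)))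
    sum-reindexed N = ≋-trans (∑-product _,_ (box N r) (triangles N r) _)
      (∑-cong (box N r) (λ row → ∑-cong (triangles N r) (λ n → inner row n)))
      where
      inner : ∀ row n → con (∏F (t ∷ ts) (row , n)) ⊗ orderedValue N (t ∷ ts) ((d ∷ ds) ÷ (row , n)) f ≋
                        ∑ (box N r) (λ l′ → Z N row n l′)
      inner row n = begin
        con (∏F (t ∷ ts) (row , n)) ⊗ orderedValue N (t ∷ ts) ((d ∷ ds) ÷ (row , n)) f
          ≈⟨ ⊗-cong (con-* _ _) (∑-product _∷_ (upTo N) (box N r) _) ⟩
        R ⊗ C ⊗ ∑ (upTo N) (λ l → ∑ (box N r) (λ l′ →
          orderedTerm (t ∷ ts) ((d ∷ ds) ÷ (row , n)) f (l ∷ l′)))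
          ≈⟨ ⊗-cong ≋-refl (≋-trans (∑-swap (upTo N) (box N r) _) (∑-cong (box N r) (λ l′ →
               ≋-trans (∑-cong (upTo N) (λ l → term-reindexed row n l l′))
                       (≋-sym (∑-*ˡ (𝐄 ts (q n l′ ⊟ row)) (upTo N) _))))) ⟩
        R ⊗ C ⊗ ∑ (box N r) (λ l′ → 𝐄 ts (q n l′ ⊟ row) ⊗ G N row l′)
          ≈⟨ ≋-trans (∑-*ˡ (R ⊗ C) (box N r) _) (∑-cong (box N r) (λ l′ →
               solve 3 (λ x y z → x :* y :* z := y :* (x :* z)) ≋-refl R C _)) ⟩
        ∑ (box N r) (λ l′ → Z N row n l′)
          ∎
        where
        R = con (∏F-row t ts row)
        C = con (∏F ts n)

    conclusion : Eventually λ N → productSum (t ∷ ts) (d ∷ ds) f N ≋ productValue (t ∷ ts) (d ∷ ds) f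
    conclusion = let M′ , eq = reordered in
      suc (degree h) ℕ.+ (M ℕ.+ M′) , λ {N} large → begin
        productSum (t ∷ ts) (d ∷ ds) f N
          ≈⟨ sum-reindexed N ⟩
        ∑ (box N r) (λ row → ∑ (triangles N r) (λ n → ∑ (box N r) (λ l′ → Z N row n l′)))
          ≈⟨ expand-bounds (ℕ.≤-trans (ℕ.m≤m+n M M′) (ℕ.m+n≤o⇒n≤o (suc (degree h)) large)) ⟨
        ∑ (triangles M r) (λ n → ∑ (box M r) (λ l′ → ∑ (box N r) (λ row → Z N row n l′)))
          ≈⟨ eq (ℕ.≤-trans (ℕ.m≤n+m M′ M) (ℕ.m+n≤o⇒n≤o (suc (degree h)) large)) ⟨
        ∑ (triangles M r) (λ n → ∑ (box M r) (λ l′ →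
          con (∏F ts n) ⊗ ∑ (upTo N) (λ l → ψ l ⊗ D t l (Y n l′))))
          ≈⟨ value-expanded (ℕ.m+n≤o⇒m≤o (suc (degree h)) large) ⟨
        productValue (t ∷ ts) (d ∷ ds) f
          ∎

  -- The formula, with the sums over all sufficiently large boxes.
  product-formula : ∀ {r} (ts : Vec Parameter r) d f →
                    Eventually λ N → productSum ts d f N ≋ productValue ts d f
  product-formula []       []       f = 0 , λ _ →
    ≋-trans (⊕-identityʳ _) (≋-trans (⊗-identityˡ _)
      (≋-trans (⊕-identityʳ _) (⊗-identityˡ f)))
  product-formula (t ∷ ts) (d ∷ ds) f = step (product-formula ts ds f)
    where
    step : Eventually (λ N → productSum ts ds f N ≋ productValue ts ds f) → _
    step (M , IH) = Step.conclusion t ts d ds f (M ℕ.⊔ (suc (degree f) ℕ.⊔ triangleBound ds f))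
      (ℕ.≤-trans (ℕ.m≤m⊔n (suc (degree f)) (triangleBound ds f)) (ℕ.m≤n⊔m M _))
      (ℕ.≤-trans (ℕ.m≤n⊔m (suc (degree f)) _) (ℕ.m≤n⊔m M _))
      (IH (ℕ.m≤m⊔n M _))

  hasSum-box : ∀ {r} N {x : Vec ℕ r → Γ} {s} → (∀ l → x l ≋ con 0# ⊎ Bounded N l) →
               ∑ (box N r) x ≋ s → HasSum x s
  hasSum-box {r} N x≋0 eq =
    box N r , box-unique N r , ∑-∉ (box N r) x≋0 (box-complete N) , eq

  𝒴-hasSum : ∀ t d f → 𝒴 t (d ∷ []) f (∑ (upTo (suc (degree f))) (λ l → Eℤ t (d ℤ.+ + l) ⊗ D t l f))
  𝒴-hasSum t d f = hasSum-box (suc (degree f)) support (begin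
    ∑ (box (suc (degree f)) 1) term
      ≈⟨ ∑-product _∷_ (upTo (suc (degree f))) ([] ∷ []) term ⟩
    ∑ (upTo (suc (degree f))) (λ l → term (l ∷ []) ⊕ con 0#)
      ≈⟨ ∑-cong (upTo (suc (degree f))) (λ l → ≋-trans (⊕-identityʳ _) (𝒴-term t (d ℤ.+ + l) l f)) ⟩
    ∑ (upTo (suc (degree f))) (λ l → Eℤ t (d ℤ.+ + l) ⊗ D t l f)
      ∎)
    where
    term : Vec ℕ 1 → Γ
    term l = OpSeries.extend (OpSeries.exp (OpSeries.inVariable zero (A t))) ((d ∷ []) ⊞ l)
      (OpSeries.exp (OpSeries.inVariable zero (B t)) l f)

    support : ∀ l → term l ≋ con 0# ⊎ Bounded (suc (degree f)) l
    support (l ∷ []) = cases (ℕ.<-≤-connex (degree f) l)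
      where
      cases : degree f < l ⊎ l ≤ degree f → term (l ∷ []) ≋ con 0# ⊎ Bounded (suc (degree f)) (l ∷ [])
      cases (inj₁ f<l) = inj₁ (≋-trans (𝒴-term t (d ℤ.+ + l) l f)
        (≋-trans (⊗-cong ≋-refl (D-degree t f l f<l)) (⊗-zeroʳ _)))
      cases (inj₂ l≤f) = inj₂ (s≤s l≤f ∷ [])

  product-value : ∀ {r} (ts : Vec Parameter r) d f → 𝒴-product ts d f (productValue ts d f)
  product-value []       []       f = ≋-refl
  product-value (t ∷ ts) (d ∷ ds) f =
    productValue ts ds f , product-value ts ds f , 𝒴-hasSum t d (productValue ts ds f)

  normallyOrdered-value : ∀ {r} (ts : Vec Parameter r) d f →
                          normallyOrdered ts d f (orderedValue (suc (degree f)) ts d f)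
  normallyOrdered-value {r} ts d f = hasSum-box (suc (degree f))
    (λ l → Sum.map₁ (≋-trans (normallyOrdered-term ts (d ⊞ l) l f)) (orderedTerm-bounded ts d f l))
    (∑-cong (box (suc (degree f)) r) (λ l → normallyOrdered-term ts (d ⊞ l) l f))

  orderedValue-bounded : ∀ {r} (ts : Vec Parameter r) d f n →
    orderedValue (suc (degree f)) ts (d ÷ n) f ≋ con 0# ⊎ TriangleBounded (triangleBound d f) n
  orderedValue-bounded {r} ts d f n = ∑-zero-or (box (suc (degree f)) r) term
    where
    term : ∀ l → orderedTerm ts (d ÷ n) f l ≋ con 0# ⊎ TriangleBounded (triangleBound d f) n
    term l = cases (orderedTerm-bounded ts (d ÷ n) f l)
      where
      cases : orderedTerm ts (d ÷ n) f l ≋ con 0# ⊎ Bounded (suc (degree f)) l →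
              orderedTerm ts (d ÷ n) f l ≋ con 0# ⊎ TriangleBounded (triangleBound d f) n
      cases (inj₁ eq)  = inj₁ eq
      cases (inj₂ l≤f) = Sum.map₁
        (λ 𝐄≋0 → ≋-trans (⊗-cong (≋-trans (ΓR.reflexive (≡.cong (𝐄 ts)
          (minus-plus d (Vec.map +_ l) (exponents n)))) 𝐄≋0) ≋-refl) (⊗-zeroˡ _))
        (𝐄-÷-bounded ts (d ⊞ l) n (⊞-≤ d l≤f) ℕ.≤-refl)

corollary3p2 : ∀ {c ℓ₁ ℓ₂} (K : HeytingField c ℓ₁ ℓ₂) (char0 : CharacteristicZero K) →
    let open Vertex K char0 in
    ∀ {r} (t : Vec Parameter r) → 𝒴-product t ≐ ∏F t ⊡ normallyOrdered t
corollary3p2 K char0 {r} t d f =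
  productValue t d f , product-value t d f ,
  (λ n → value n) , (λ n → normallyOrdered-value t (d ÷ n) f) ,
  triangles N r , triangles-unique N r , ∑-∉ (triangles N r) support (triangles-complete N) , sum
  where
  open Coefficients K char0
  open Ordering K char0
  open Boxes Γ-semiring
  open SetoidReasoning ΓR.setoid

  value : Triangle r → Γ
  value n = orderedValue (suc (degree f)) t (d ÷ n) f

  M = proj₁ (product-formula t d f)
  N = M ℕ.+ (triangleBound d f ℕ.+ suc (degree f))

  support : ∀ n → con (∏F t n) ⊗ value n ≋ con 0# ⊎ TriangleBounded N n
  support n = Sum.map (λ x≋0 → ≋-trans (⊗-cong ≋-refl x≋0) (⊗-zeroʳ _))
    (triangleBounded-≤ n (ℕ.≤-trans (ℕ.m≤m+n _ (suc (degree f))) (ℕ.m≤n+m _ M)))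
    (orderedValue-bounded t d f n)
    where
    triangleBounded-≤ : ∀ {r M N} (n : Triangle r) → M ≤ N → TriangleBounded M n → TriangleBounded N n
    triangleBounded-≤ {zero}  tt        M≤N _             = tt
    triangleBounded-≤ {suc r} (row , n) M≤N (row<M , n<M) =
      All.map (λ i<M → ℕ.<-≤-trans i<M M≤N) row<M , triangleBounded-≤ n M≤N n<M

  sum : ∑ (triangles N r) (λ n → con (∏F t n) ⊗ value n) ≋ productValue t d f
  sum = ≋-trans
    (∑-cong (triangles N r) (λ n → ⊗-cong ≋-refl (≋-sym (∑-box-extend r
      (ℕ.≤-trans (ℕ.m≤n+m _ (triangleBound d f)) (ℕ.m≤n+m _ M)) (orderedTerm-bounded t (d ÷ n) f)))))
    (proj₂ (product-formula t d f) (ℕ.m≤m+n M _))
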